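{- Let $k\ge 2$ be an integer. For any odd positive integer $m$, the set $$E_k(m)=\left\{p : p\text{ is an odd prime with } 2k\mid (p-1)\text{ and } p\mid S_{m+\frac{p-1}{k},k}(-1,p)\right\}$$ is finite. Moreover, $E_k(1)=\emptyset$, and if $m\ge 3$ is odd and $p$ is a prime with $p>km+1$, then $p\in E_k(m)$ if and only if $p\equiv 1\pmod{2k}$ and either $$p\ \Big|\ \left((km)!_{(k)}+(km-1)!_{(k)}\right)$$ or $$p\ \Big|\ \left(\frac{(km-kl)!_{(k)}}{(kl)!_{(k)}}+\frac{(km-kl-1)!_{(k)}}{(kl-1)!_{(k)}}\right)\quad\text{for some } l\in\left\{1,\ldots,\tfrac{m-1}{2}\right\}.$$
   Context: For an odd prime $p$ and an integer $k\ge 2$ with $k\mid p-1$, let $\alpha_1,\ldots,\alpha_{(p-1)/k}$ be integers representing the distinct (nonzero) $k$-th power residues modulo $p$. For $n\in\mathbb{N}$ and $d\in\mathbb{Z}$, $$S_{n,k}(d,p)=\det\left[(\alpha_i+d\,\alpha_j)^n\right]_{1\le i,j\le \frac{p-1}{k}}$$ (whether $p$ divides it does not depend on the choice of representatives). For $a,e\in\mathbb{N}$, the $e$-factorial $a!_{(e)}$ is defined recursively by $a!_{(e)}=a\cdot (a-e)!_{(e)}$ if $a>e$, and $a!_{(e)}=a$ if $1\le a\le e$. -}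

module Defs where

import Algebra.Properties.Semiring.Sum as SemiringSum
open import Data.Bool.Base using (true; false; if_then_else_; T)
open import Data.Fin.Base using (Fin; zero; suc; toℕ; punchIn)
open import Data.Integer.Base as ℤ using (ℤ; +_; -_; 0ℤ; 1ℤ; -1ℤ)
import Data.Integer.Divisibility as ℤ
import Data.Integer.Properties as ℤ
open import Data.List.Base using (List)
import Data.List.Membership.Propositional as List
open import Data.Nat.Base
open import Data.Nat.DivMod using (_/_; m/n*n≡m)
open import Data.Nat.Divisibility using (_∣_; ∣-refl; ∣n⇒∣m*n)
open import Data.Nat.Primality using (Prime)
open import Data.Nat.Properties
open import Data.Product.Base using (_×_; ∃)
open import Function.Bundles using (_⇔_)
open import Level using (0ℓ)
open import Relation.Binary.PropositionalEquality
open import Relation.Nullary.Negation.Core using (¬_; contradiction)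
open import Relation.Unary using (Pred)

open SemiringSum ℤ.+-*-semiring using (sum)

Odd : ℕ → Set
Odd n = ¬ (2 ∣ n)

-- Every member is listed and everything listed is a member (repetitions in the
-- list are harmless).
Finite : Pred ℕ 0ℓ → Set
Finite P = ∃ λ (xs : List ℕ) → ∀ n → P n ⇔ (n List.∈ xs)

infix 4 _≡_[mod_]
_≡_[mod_] : ℤ → ℤ → ℕ → Set
a ≡ b [mod n ] = + n ℤ.∣ a ℤ.- b

Matrix : ℕ → Set
Matrix n = Fin n → Fin n → ℤ

-- Laplace expansion along the first row.
det : ∀ {n} → Matrix n → ℤ
det {zero}  A = 1ℤ
det {suc n} A = sum λ j →
  -1ℤ ℤ.^ toℕ j ℤ.* A zero j ℤ.* det λ r c → A (suc r) (punchIn j c)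

IsNonzeroPowerResidue : (k p : ℕ) → ℤ → Set
IsNonzeroPowerResidue k p a =
  ¬ (a ≡ 0ℤ [mod p ]) × ∃ λ x → x ℤ.^ k ≡ a [mod p ]

record RepresentsPowerResidues (k p : ℕ) .{{_ : NonZero k}}
                               (α : Fin ((p ∸ 1) / k) → ℤ) : Set where
  field
    residue  : ∀ i → IsNonzeroPowerResidue k p (α i)
    distinct : ∀ i j → α i ≡ α j [mod p ] → i ≡ j
    complete : ∀ a → IsNonzeroPowerResidue k p a → ∃ λ i → α i ≡ a [mod p ]

S : ∀ {N} (n : ℕ) (d : ℤ) (α : Fin N → ℤ) → ℤ
S n d α = det λ i j → (α i ℤ.+ d ℤ.* α j) ℤ.^ n

-- The set E_k(m).  The family α supplies, for each p, the representatives of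
-- the k-th power residues from which the determinant is formed.
E : (k : ℕ) .{{_ : NonZero k}} → ((p : ℕ) → Fin ((p ∸ 1) / k) → ℤ) →
    ℕ → Pred ℕ 0ℓ
E k α m p =
  Prime p × Odd p × 2 * k ∣ p ∸ 1 × + p ℤ.∣ S (m + (p ∸ 1) / k) -1ℤ (α p)

-- The e-factorial a!_(e).  The first argument of the auxiliary function bounds
-- the recursion depth; when e ≥ 1, depth a suffices, and the recursion
-- equations for a ≥ 1 are !-base and !-step below.  As a convention, 0!_(e) = 1.
factorial-aux : ℕ → ℕ → ℕ → ℕ
factorial-aux zero    a       e = 1
factorial-aux (suc f) zero    e = 1
factorial-aux (suc f) a@(suc _) e =
  if a ≤ᵇ e then a else a * factorial-aux f (a ∸ e) e

infix 8 _!⟨_⟩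
_!⟨_⟩ : ℕ → ℕ → ℕ
a !⟨ e ⟩ = factorial-aux a a e

private
  ≤ᵇ-true : ∀ {a e} → a ≤ e → (a ≤ᵇ e) ≡ true
  ≤ᵇ-true {a} {e} a≤e with a ≤ᵇ e | ≤⇒≤ᵇ a≤e
  ... | true | _ = refl

  ≤ᵇ-false : ∀ {a e} → e < a → (a ≤ᵇ e) ≡ false
  ≤ᵇ-false {a} {e} e<a with a ≤ᵇ e in eq
  ... | false = refl
  ... | true  = contradiction (≤ᵇ⇒≤ a e (subst T (sym eq) _)) (<⇒≱ e<a)

  suc∸≤ : ∀ {f} a e .{{_ : NonZero e}} → suc a ≤ suc f → suc a ∸ e ≤ f
  suc∸≤ a (suc e) (s≤s a≤f) = ≤-trans (m∸n≤m a e) a≤f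

  aux-depth : ∀ f g a e .{{_ : NonZero e}} → a ≤ f → a ≤ g →
              factorial-aux f a e ≡ factorial-aux g a e
  aux-depth zero    zero    zero    e _ _ = refl
  aux-depth zero    (suc g) zero    e _ _ = refl
  aux-depth (suc f) zero    zero    e _ _ = refl
  aux-depth (suc f) (suc g) zero    e _ _ = refl
  aux-depth (suc f) (suc g) (suc a) e a≤f a≤g =
    cong (λ t → if suc a ≤ᵇ e then suc a else suc a * t)
         (aux-depth f g (suc a ∸ e) e (suc∸≤ a e a≤f) (suc∸≤ a e a≤g))

  aux-nonZero : ∀ f a e → NonZero (factorial-aux f a e)
  aux-nonZero zero    a       e = _
  aux-nonZero (suc f) zero    e = _
  aux-nonZero (suc f) (suc a) e with suc a ≤ᵇ e
  ... | true  = _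
  ... | false =
    m*n≢0 (suc a) (factorial-aux f (suc a ∸ e) e)
          {{_}} {{aux-nonZero f (suc a ∸ e) e}}

!-base : ∀ a e → 1 ≤ a → a ≤ e → a !⟨ e ⟩ ≡ a
!-base (suc a) e _ a≤e rewrite ≤ᵇ-true a≤e = refl

!-step : ∀ a e .{{_ : NonZero e}} → e < a → a !⟨ e ⟩ ≡ a * (a ∸ e) !⟨ e ⟩
!-step (suc a) e e<a rewrite ≤ᵇ-false e<a =
  cong (suc a *_)
       (aux-depth a (suc a ∸ e) (suc a ∸ e) e (suc∸≤ a e ≤-refl) ≤-refl)

!-nonZero : ∀ a e → NonZero (a !⟨ e ⟩)
!-nonZero a e = aux-nonZero a a e

-- b!_(e) / a!_(e).  When 1 ≤ a ≤ b and a ≡ b (mod e) the quotient is an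
-- integer, so the truncating division of ℕ is exact: see !-quotient-exact.
!-quotient : (e b a : ℕ) → ℕ
!-quotient e b a = (b !⟨ e ⟩ / a !⟨ e ⟩) {{ !-nonZero a e }}

!-∣-! : ∀ a j e .{{_ : NonZero e}} → 1 ≤ a → a !⟨ e ⟩ ∣ (j * e + a) !⟨ e ⟩
!-∣-! a zero    e 1≤a = ∣-refl
!-∣-! a (suc j) e 1≤a =
  subst (a !⟨ e ⟩ ∣_) (sym (!-step (e + j * e + a) e e<b))
    (∣n⇒∣m*n (e + j * e + a)
      (subst (λ t → a !⟨ e ⟩ ∣ t !⟨ e ⟩) (sym b∸e) (!-∣-! a j e 1≤a)))
  where
  b∸e : e + j * e + a ∸ e ≡ j * e + a
  b∸e = trans (cong (_∸ e) (+-assoc e (j * e) a)) (m+n∸m≡n e (j * e + a))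

  e<b : e < e + j * e + a
  e<b = ≤-trans (≤-reflexive (+-comm 1 e))
                (+-mono-≤ (m≤m+n e (j * e)) 1≤a)

!-quotient-exact : ∀ a j e .{{_ : NonZero e}} → 1 ≤ a →
                   !-quotient e (j * e + a) a * a !⟨ e ⟩ ≡ (j * e + a) !⟨ e ⟩
!-quotient-exact a j e 1≤a = m/n*n≡m {{ !-nonZero a e }} (!-∣-! a j e 1≤a)

module Submission where

-- Let N = (p − 1)/k and n = m + N.  Expand (x − y)ⁿ by the binomial theorem and
-- reduce the exponents with xᴺ ≡ yᴺ ≡ 1: the matrix becomes X · diag(c) · W with
-- X and W of Vandermonde type, hence invertible modulo p, and, N being even,
-- c_b = ± (C(n, b) + C(n, N + b)) for 0 ≤ b < N.  So p divides the determinant iff it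
-- divides some c_b.  For m < b this is impossible, since n < p; for b ≤ m the second
-- summand is C(n, m − b), so b and m − b give the same condition.  Multiplying by
-- factors prime to p and using k N ≡ −1 turns it into the stated one on k-factorials.
-- The numbers to be divided are positive and bounded in terms of k and m, whence the
-- finiteness.

open import Defs

-- The determinant is given only as a Laplace expansion along the first row, so using the
-- factorisation requires multiplicativity. That comes from uniqueness: every alternating form is a
-- multiple of `det`, and A ↦ det (A B) is such a form. Work modulo p stays in ℤ: inverses are the
-- powers x^(N - 1), and a Vandermonde matrix is shown invertible by multiplying it with
-- unnormalised Lagrange coefficients, which gives a diagonal matrix. The link to k-factorials is an
-- invariant. With Q i = k^i i! and R i the product of k t - 1 over 1 ≤ t ≤ i, the number Q i R (m -
-- i) C(n, i) is congruent to R m for every i ≤ m. Comparing i = l with i = m - l gives C(n, l) :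
-- C(n, m - l) = q : r modulo p, where q = Q (m - l) / Q l and r = R (m - l) / R l. Hence p divides
-- the sum of the two binomials exactly when it divides q + r. The first divisibility of the theorem
-- is the case l = 0. Since m = 2 h + 1, the pairs b, m - b are represented by 0 ≤ l ≤ h; and p > k
-- m + 1 says that m < N.

module Determinants where
  import Algebra.Properties.Semiring.Sum as SemiringSum
  open import Data.Fin.Base using (Fin; zero; suc; toℕ; punchIn; punchOut; inject₁)
  open import Data.Fin.Properties using (suc-injective; _≟_; toℕ-inject₁; punchIn-punchOut)
  open import Data.Fin.Induction using (<-weakInduction)
  open import Data.Integer.Base as ℤ using (ℤ; -_; 0ℤ; 1ℤ; -1ℤ; _+_; _*_; _^_)
  import Data.Integer.Properties as ℤ
  open import Data.Integer.Tactic.RingSolver using (solve-∀)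
  open import Data.Nat.Base as ℕ using (ℕ; zero; suc)
  open import Data.Vec.Functional using (Vector; updateAt; insertAt; _∷_; foldr)
  open import Data.Vec.Functional.Properties
    using (updateAt-updates; updateAt-minimal; insertAt-lookup; insertAt-punchIn)
  open import Function.Base using (_∘_; const)
  open import Relation.Binary.PropositionalEquality
  open import Relation.Nullary.Decidable.Core using (yes; no)
  open import Relation.Nullary.Negation.Core using (contradiction)
  open SemiringSum ℤ.+-*-semiring
    using (sum; sum-cong-≗; *-distribˡ-sum; *-distribʳ-sum; ∑-distrib-+)

  open ≡-Reasoning

  private
    variable
      n : ℕ

  sum-zero : (f : Vector ℤ n) → (∀ i → f i ≡ 0ℤ) → sum f ≡ 0ℤ
  sum-zero {zero}  f f≗0 = refl
  sum-zero {suc n} f f≗0 = cong₂ _+_ (f≗0 zero) (sum-zero (f ∘ suc) (f≗0 ∘ suc))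

  sum-linear : ∀ s t (f g h : Vector ℤ n) → (∀ i → h i ≡ s * f i + t * g i) →
               sum h ≡ s * sum f + t * sum g
  sum-linear s t f g h h≗ = begin
    sum h                                            ≡⟨ sum-cong-≗ h≗ ⟩
    sum (λ i → s * f i + t * g i)
      ≡⟨ ∑-distrib-+ (λ i → s * f i) (λ i → t * g i) ⟩
    sum (λ i → s * f i) + sum (λ i → t * g i)
      ≡⟨ cong₂ _+_ (*-distribˡ-sum s f) (*-distribˡ-sum t g) ⟨
    s * sum f + t * sum g                            ∎

  -- Alternating forms in the rows of a matrix.

  infixl 9 _[_≔_]

  _[_≔_] : ∀ {A : Set} → Vector A n → Fin n → A → Vector A n
  A [ i ≔ v ] = updateAt A i (const v)

  infix 4 _≈ₘ_

  _≈ₘ_ : ∀ {m} (A B : Fin m → Vector ℤ n) → Set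
  A ≈ₘ B = ∀ i j → A i j ≡ B i j

  -- Matrices are functions, and pointwise equal ones need not be propositionally equal; hence
  -- `respects`. `linear` compares three matrices that agree off row `i`, rather than updates of one
  -- matrix, so that it applies to rows in whatever form they are presented.
  record IsAlternating {n} (f : Matrix n → ℤ) : Set where
    field
      respects    : ∀ {A B} → A ≈ₘ B → f A ≡ f B
      linear      : ∀ i s t {A B C} →
                    (∀ r → r ≢ i → ∀ j → A r j ≡ C r j) →
                    (∀ r → r ≢ i → ∀ j → B r j ≡ C r j) →
                    (∀ j → C i j ≡ s * A i j + t * B i j) →
                    f C ≡ s * f A + t * f B
      alternating : ∀ {A} i j → i ≢ j → (∀ c → A i c ≡ A j c) → f A ≡ 0ℤ

    linear-[≔] : ∀ A i s t u v w → (∀ c → w c ≡ s * u c + t * v c) →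
                 f (A [ i ≔ w ]) ≡ s * f (A [ i ≔ u ]) + t * f (A [ i ≔ v ])
    linear-[≔] A i s t u v w w≗ = linear i s t (off u) (off v) on
      where
      off : ∀ u r → r ≢ i → ∀ c → (A [ i ≔ u ]) r c ≡ (A [ i ≔ w ]) r c
      off u r r≢i c = cong-app (trans (updateAt-minimal r i A r≢i)
                                      (sym (updateAt-minimal r i A r≢i))) c

      at : ∀ u c → (A [ i ≔ u ]) i c ≡ u c
      at u = cong-app (updateAt-updates i A)

      on : ∀ c → (A [ i ≔ w ]) i c
               ≡ s * (A [ i ≔ u ]) i c + t * (A [ i ≔ v ]) i c
      on c = trans (at w c) (trans (w≗ c)
               (sym (cong₂ (λ x y → s * x + t * y) (at u c) (at v c))))

    -- With u + v in both rows the form vanishes. Expanding both rows by linearity, F(u, u) and F(v,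
    -- v) vanish as well, which leaves F(u, v) + F(v, u) = 0.
    antisymmetric : ∀ {A B} i j → i ≢ j → (∀ c → B i c ≡ A j c) →
                    (∀ c → B j c ≡ A i c) →
                    (∀ r → r ≢ i → r ≢ j → ∀ c → B r c ≡ A r c) → f B ≡ - f A
    antisymmetric {A} {B} i j i≢j Bi Bj B≗ = begin
      f B                                    ≡⟨ respects B≈ ⟩
      F v u                                  ≡⟨ rearrange (F u u) (F u v) (F v u) (F v v) ⟩
      1ℤ * (1ℤ * F u u + 1ℤ * F u v) + 1ℤ * (1ℤ * F v u + 1ℤ * F v v)
        + (- F u v + (- F u u + - F v v))
        ≡⟨ cong₂ _+_ (sym expand)
             (cong (λ z → - F u v + z) (cong₂ (λ x y → - x + - y) (diag u) (diag v))) ⟩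
      F w w + (- F u v + 0ℤ)                 ≡⟨ cong₂ _+_ (diag w) (ℤ.+-identityʳ (- F u v)) ⟩
      0ℤ + - F u v                           ≡⟨ ℤ.+-identityˡ (- F u v) ⟩
      - F u v                                ≡⟨ cong -_ (respects A≈) ⟨
      - f A                                  ∎
      where
      u = A i
      v = A j
      w : Vector ℤ n
      w c = 1ℤ * u c + 1ℤ * v c

      M : (x y : Vector ℤ n) → Matrix n
      M x y = A [ i ≔ x ] [ j ≔ y ]

      F : (x y : Vector ℤ n) → ℤ
      F x y = f (M x y)

      M-i : ∀ x y → M x y i ≡ x
      M-i x y = trans (updateAt-minimal i j _ i≢j) (updateAt-updates i A)

      M-j : ∀ x y → M x y j ≡ y
      M-j x y = updateAt-updates j _

      M-off : ∀ x y r → r ≢ i → r ≢ j → M x y r ≡ A r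
      M-off x y r r≢i r≢j = trans (updateAt-minimal r j _ r≢j) (updateAt-minimal r i A r≢i)

      ≈M : ∀ {C x y} → (∀ c → C i c ≡ x c) → (∀ c → C j c ≡ y c) →
           (∀ r → r ≢ i → r ≢ j → ∀ c → C r c ≡ A r c) → C ≈ₘ M x y
      ≈M {C} {x} {y} Ci Cj C≗ r c with r ≟ i | r ≟ j
      ... | yes refl | _        = trans (Ci c) (sym (cong-app (M-i x y) c))
      ... | no _     | yes refl = trans (Cj c) (sym (cong-app (M-j x y) c))
      ... | no r≢i   | no r≢j   = trans (C≗ r r≢i r≢j c)
                                        (sym (cong-app (M-off x y r r≢i r≢j) c))

      A≈ : A ≈ₘ M u v
      A≈ = ≈M (λ _ → refl) (λ _ → refl) (λ _ _ _ _ → refl)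

      B≈ : B ≈ₘ M v u
      B≈ = ≈M Bi Bj B≗

      diag : ∀ x → F x x ≡ 0ℤ
      diag x = alternating i j i≢j (cong-app (trans (M-i x x) (sym (M-j x x))))

      linearˡ : ∀ y → F w y ≡ 1ℤ * F u y + 1ℤ * F v y
      linearˡ y = linear i 1ℤ 1ℤ (off u) (off v) λ c → begin
        M w y i c                          ≡⟨ cong-app (M-i w y) c ⟩
        w c                                ≡⟨ cong₂ (λ p q → 1ℤ * p + 1ℤ * q)
                                                (cong-app (M-i u y) c) (cong-app (M-i v y) c) ⟨
        1ℤ * M u y i c + 1ℤ * M v y i c    ∎
        where
        off : ∀ x r → r ≢ i → ∀ c → M x y r c ≡ M w y r c
        off x r r≢i c with r ≟ j
        ... | yes refl = cong-app (trans (M-j x y) (sym (M-j w y))) c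
        ... | no r≢j   = cong-app (trans (M-off x y r r≢i r≢j)
                                         (sym (M-off w y r r≢i r≢j))) c

      linearʳ : ∀ x → F x w ≡ 1ℤ * F x u + 1ℤ * F x v
      linearʳ x = linear-[≔] (A [ i ≔ x ]) j 1ℤ 1ℤ u v w (λ _ → refl)

      expand : F w w ≡ 1ℤ * (1ℤ * F u u + 1ℤ * F u v) + 1ℤ * (1ℤ * F v u + 1ℤ * F v v)
      expand = trans (linearˡ w)
                 (cong₂ (λ p q → 1ℤ * p + 1ℤ * q) (linearʳ u) (linearʳ v))

      rearrange : ∀ a b c d → c ≡ 1ℤ * (1ℤ * a + 1ℤ * b) + 1ℤ * (1ℤ * c + 1ℤ * d)
                                    + (- b + (- a + - d))
      rearrange = solve-∀

    -- By linearity in row `i` the difference is `t` times the value at `D`, in which row `j` occurs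
    -- twice.
    add-multiple : ∀ {A B} i j t → i ≢ j → (∀ r → r ≢ i → ∀ c → B r c ≡ A r c) →
                   (∀ c → B i c ≡ A i c + t * A j c) → f B ≡ f A
    add-multiple {A} {B} i j t i≢j B≗ Bi = begin
      f B                            ≡⟨ linear i 1ℤ t (λ r r≢i c → sym (B≗ r r≢i c)) off on ⟩
      1ℤ * f A + t * f D             ≡⟨ cong (λ z → 1ℤ * f A + t * z) D≡0 ⟩
      1ℤ * f A + t * 0ℤ              ≡⟨ cong₂ _+_ (ℤ.*-identityˡ (f A)) (ℤ.*-zeroʳ t) ⟩
      f A + 0ℤ                       ≡⟨ ℤ.+-identityʳ (f A) ⟩
      f A                            ∎
      where
      D = A [ i ≔ A j ]

      off : ∀ r → r ≢ i → ∀ c → D r c ≡ B r c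
      off r r≢i c = trans (cong-app (updateAt-minimal r i A r≢i) c) (sym (B≗ r r≢i c))

      on : ∀ c → B i c ≡ 1ℤ * A i c + t * D i c
      on c = trans (Bi c) (cong₂ _+_ (sym (ℤ.*-identityˡ (A i c)))
               (cong (t *_) (sym (cong-app (updateAt-updates i A) c))))

      D≡0 : f D ≡ 0ℤ
      D≡0 = alternating i j i≢j
              (cong-app (trans (updateAt-updates i A)
                               (sym (updateAt-minimal j i A (i≢j ∘ sym)))))

  -- The Laplace expansion is alternating.

  minor : Matrix (suc n) → Fin (suc n) → Matrix n
  minor A j r c = A (suc r) (punchIn j c)

  det-respects : {A B : Matrix n} → A ≈ₘ B → det A ≡ det B
  det-respects {zero}  A≈B = refl
  det-respects {suc n} A≈B = sum-cong-≗ λ j →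
    cong₂ (λ x y → -1ℤ ^ toℕ j * x * y) (A≈B zero j)
          (det-respects λ r c → A≈B (suc r) (punchIn j c))

  det-linear : ∀ i s t {A B C : Matrix n} →
               (∀ r → r ≢ i → ∀ j → A r j ≡ C r j) →
               (∀ r → r ≢ i → ∀ j → B r j ≡ C r j) →
               (∀ j → C i j ≡ s * A i j + t * B i j) →
               det C ≡ s * det A + t * det B
  det-linear {suc n} zero s t {A} {B} {C} A≗ B≗ Ci = sum-linear s t _ _ _ λ j → begin
    -1ℤ ^ toℕ j * C zero j * det (minor C j)
      ≡⟨ cong (λ z → -1ℤ ^ toℕ j * z * det (minor C j)) (Ci j) ⟩
    -1ℤ ^ toℕ j * (s * A zero j + t * B zero j) * det (minor C j)
      ≡⟨ distribute (-1ℤ ^ toℕ j) s t (A zero j) (B zero j) (det (minor C j)) ⟩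
    s * (-1ℤ ^ toℕ j * A zero j * det (minor C j)) + t * (-1ℤ ^ toℕ j * B zero j * det (minor C j))
      ≡⟨ cong₂ (λ y z → s * (-1ℤ ^ toℕ j * A zero j * y) + t * (-1ℤ ^ toℕ j * B zero j * z))
           (det-respects λ r c → A≗ (suc r) (λ ()) (punchIn j c))
           (det-respects λ r c → B≗ (suc r) (λ ()) (punchIn j c)) ⟨
    s * (-1ℤ ^ toℕ j * A zero j * det (minor A j)) + t * (-1ℤ ^ toℕ j * B zero j * det (minor B j))
      ∎
    where
    distribute : ∀ e s t a b d → e * (s * a + t * b) * d ≡ s * (e * a * d) + t * (e * b * d)
    distribute = solve-∀
  det-linear {suc n} (suc i) s t {A} {B} {C} A≗ B≗ Ci = sum-linear s t _ _ _ λ j → begin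
    -1ℤ ^ toℕ j * C zero j * det (minor C j)
      ≡⟨ cong (-1ℤ ^ toℕ j * C zero j *_)
           (det-linear i s t
             (λ r r≢i c → A≗ (suc r) (r≢i ∘ suc-injective) (punchIn j c))
             (λ r r≢i c → B≗ (suc r) (r≢i ∘ suc-injective) (punchIn j c))
             (Ci ∘ punchIn j)) ⟩
    -1ℤ ^ toℕ j * C zero j * (s * det (minor A j) + t * det (minor B j))
      ≡⟨ distribute (-1ℤ ^ toℕ j) s t (C zero j) (det (minor A j)) (det (minor B j)) ⟩
    s * (-1ℤ ^ toℕ j * C zero j * det (minor A j)) + t * (-1ℤ ^ toℕ j * C zero j * det (minor B j))
      ≡⟨ cong₂ (λ y z → s * (-1ℤ ^ toℕ j * y * det (minor A j))
                      + t * (-1ℤ ^ toℕ j * z * det (minor B j)))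
           (A≗ zero (λ ()) j) (B≗ zero (λ ()) j) ⟨
    s * (-1ℤ ^ toℕ j * A zero j * det (minor A j)) + t * (-1ℤ ^ toℕ j * B zero j * det (minor B j))
      ∎
    where
    distribute : ∀ e s t a x y → e * a * (s * x + t * y) ≡ s * (e * a * x) + t * (e * a * y)
    distribute = solve-∀

  -- The pair (j , k) stands for the two distinct columns j and punchIn j k;
  -- related pairs stand for the same columns in opposite orders.
  data Swapped : ∀ {n} → Fin (suc n) → Fin n → Fin (suc n) → Fin n → Set where
    swap-zero : (k : Fin (suc n)) → Swapped zero k (suc k) zero
    swap-suc : ∀ {j j′ : Fin (suc n)} {k k′} → Swapped j k j′ k′ →
           Swapped (suc j) (suc k) (suc j′) (suc k′)

  swapped-fst : ∀ {j j′ : Fin (suc n)} {k k′} → Swapped j k j′ k′ → punchIn j k ≡ j′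
  swapped-fst (swap-zero k) = refl
  swapped-fst (swap-suc s) = cong suc (swapped-fst s)

  swapped-snd : ∀ {j j′ : Fin (suc n)} {k k′} → Swapped j k j′ k′ → punchIn j′ k′ ≡ j
  swapped-snd (swap-zero k) = refl
  swapped-snd (swap-suc s) = cong suc (swapped-snd s)

  swapped-rest : ∀ {j j′ : Fin (suc (suc n))} {k k′} → Swapped j k j′ k′ →
                 ∀ c → punchIn j (punchIn k c) ≡ punchIn j′ (punchIn k′ c)
  swapped-rest (swap-zero k)         c       = refl
  swapped-rest (swap-suc s)         zero    = refl
  swapped-rest {suc n} (swap-suc s) (suc c) = cong suc (swapped-rest s c)

  -- The pair (zero , k) has sign (-1)^k and its partner (suc k , zero) has sign (-1)^(k + 1). So
  -- the pairs that involve column zero, collected in `a` and `b`, cancel; in the others both signs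
  -- flip, and they form the same sum with one column fewer.
  alternating-sum : (h : Fin (suc n) → Fin n → ℤ) →
    (∀ {j k j′ k′} → Swapped j k j′ k′ → h j k ≡ h j′ k′) →
    sum (λ j → sum λ k → -1ℤ ^ toℕ j * -1ℤ ^ toℕ k * h j k) ≡ 0ℤ
  alternating-sum {zero}  h sw = refl
  alternating-sum {suc n} h sw = begin
    sum a + sum (λ j → b j + sum (c j))          ≡⟨ cong (_+_ (sum a)) (∑-distrib-+ b (sum ∘ c)) ⟩
    sum a + (sum b + sum (sum ∘ c))              ≡⟨ ℤ.+-assoc (sum a) (sum b) (sum (sum ∘ c)) ⟨
    sum a + sum b + sum (sum ∘ c)                ≡⟨ cong₂ _+_ cancel inner ⟩
    0ℤ                                           ∎
    where
    e : ∀ {m} → Fin m → ℤ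
    e j = -1ℤ ^ toℕ j

    a b : Fin (suc n) → ℤ
    a k = 1ℤ * e k * h zero k
    b j = -1ℤ * e j * 1ℤ * h (suc j) zero

    c : Fin (suc n) → Fin n → ℤ
    c j k = -1ℤ * e j * (-1ℤ * e k) * h (suc j) (suc k)

    signs : ∀ x y z → -1ℤ * x * (-1ℤ * y) * z ≡ x * y * z
    signs = solve-∀

    opposite-signs : ∀ x z → 1ℤ * x * z + -1ℤ * x * 1ℤ * z ≡ 0ℤ
    opposite-signs = solve-∀

    cancel : sum a + sum b ≡ 0ℤ
    cancel = trans (sym (∑-distrib-+ a b)) (sum-zero (λ k → a k + b k) λ k →
      trans (cong (λ z → 1ℤ * e k * z + b k) (sw (swap-zero k)))
            (opposite-signs (e k) (h (suc k) zero)))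

    inner : sum (sum ∘ c) ≡ 0ℤ
    inner = trans
      (sum-cong-≗ λ j → sum-cong-≗ λ k → signs (e j) (e k) (h (suc j) (suc k)))
      (alternating-sum (λ j k → h (suc j) (suc k)) (sw ∘ swap-suc))

  -- Expansion along the first two rows yields a signed sum over ordered pairs of distinct columns.
  -- When the two rows are equal, the summand depends only on the unordered pair.
  det-equal-first-rows : {A : Matrix (suc (suc n))} →
                         (∀ c → A zero c ≡ A (suc zero) c) → det A ≡ 0ℤ
  det-equal-first-rows {n} {A} A₀≗A₁ = trans
    (sum-cong-≗ λ j → trans
      (*-distribˡ-sum (-1ℤ ^ toℕ j * A zero j)
          (λ k → -1ℤ ^ toℕ k * A (suc zero) (punchIn j k) * det (rest j k)))
      (sum-cong-≗ λ k → rearrange (-1ℤ ^ toℕ j) (A zero j) (-1ℤ ^ toℕ k)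
                          (A (suc zero) (punchIn j k)) (det (rest j k))))
    (alternating-sum h sw)
    where
    rest : Fin (suc (suc n)) → Fin (suc n) → Matrix n
    rest j k r c = A (suc (suc r)) (punchIn j (punchIn k c))

    h : Fin (suc (suc n)) → Fin (suc n) → ℤ
    h j k = A zero j * A (suc zero) (punchIn j k) * det (rest j k)

    rearrange : ∀ a b c d e → a * b * (c * d * e) ≡ a * c * (b * d * e)
    rearrange = solve-∀

    sw : ∀ {j k j′ k′} → Swapped j k j′ k′ → h j k ≡ h j′ k′
    sw {j} {k} {j′} {k′} s = cong₂ _*_
      (begin
        A zero j * A (suc zero) (punchIn j k)     ≡⟨ cong (A zero j *_) (A₀≗A₁ (punchIn j k)) ⟨
        A zero j * A zero (punchIn j k)
          ≡⟨ cong₂ (λ x y → A zero x * A zero y) (sym (swapped-snd s)) (swapped-fst s) ⟩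
        A zero (punchIn j′ k′) * A zero j′        ≡⟨ cong (_* A zero j′) (A₀≗A₁ (punchIn j′ k′)) ⟩
        A (suc zero) (punchIn j′ k′) * A zero j′  ≡⟨ ℤ.*-comm (A (suc zero) (punchIn j′ k′))
            (A zero j′) ⟩
        A zero j′ * A (suc zero) (punchIn j′ k′)  ∎)
      (det-respects λ r c → cong (A (suc (suc r))) (swapped-rest s c))

  -- Packages the induction hypothesis of `det-equal-rows`, whose step needs antisymmetry for the
  -- minors.
  equal-rows⇒isAlternating :
    (∀ {A : Matrix n} i j → i ≢ j → (∀ c → A i c ≡ A j c) → det A ≡ 0ℤ) →
    IsAlternating (det {n})
  equal-rows⇒isAlternating equal-rows = record
    { respects    = det-respects
    ; linear      = det-linear
    ; alternating = equal-rows
    }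

  det-first-row-repeated : IsAlternating (det {n}) → ∀ {A : Matrix (suc n)} j →
                           (∀ c → A zero c ≡ A (suc j) c) → det A ≡ 0ℤ
  det-first-row-repeated {suc n} isAlt {A} zero A₀≗A₁ = det-equal-first-rows {A = A} A₀≗A₁
  -- Exchanging the rows suc zero and suc (suc j) negates every minor.
  det-first-row-repeated {suc n} isAlt {A} (suc j) A₀≗Aj = begin
    det A
      ≡⟨ sum-cong-≗ (λ c → trans (cong (-1ℤ ^ toℕ c * A zero c *_) (negated c))
                                  (pull-neg (-1ℤ ^ toℕ c * A zero c) (det (minor A′ c)))) ⟩
    sum (λ c → - 1ℤ * (-1ℤ ^ toℕ c * A zero c * det (minor A′ c)))
      ≡⟨ *-distribˡ-sum (- 1ℤ) (λ c → -1ℤ ^ toℕ c * A zero c * det (minor A′ c)) ⟨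
    - 1ℤ * det A′
      ≡⟨ cong (- 1ℤ *_) (det-equal-first-rows {A = A′} A₀≗Aj) ⟩
    0ℤ ∎
    where
    lower : Fin n → Vector ℤ (suc (suc n))
    lower r = A (suc (suc r))

    A′ : Matrix (suc (suc n))
    A′ zero          = A zero
    A′ (suc zero)    = A (suc (suc j))
    A′ (suc (suc r)) = (lower [ j ≔ A (suc zero) ]) r

    pull-neg : ∀ a d → a * (- d) ≡ - 1ℤ * (a * d)
    pull-neg = solve-∀

    negated : ∀ c → det (minor A c) ≡ - det (minor A′ c)
    negated c = IsAlternating.antisymmetric isAlt
      {A = minor A′ c} {B = minor A c} zero (suc j) (λ ())
      (λ d → cong-app (sym (updateAt-updates j lower)) (punchIn c d))
      (λ d → refl) others
      where
      others : ∀ r → r ≢ zero → r ≢ suc j → ∀ d → minor A c r d ≡ minor A′ c r d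
      others zero    r≢0 r≢j d = contradiction refl r≢0
      others (suc r) r≢0 r≢j d =
        cong-app (sym (updateAt-minimal r j lower (r≢j ∘ cong suc))) (punchIn c d)

  det-equal-rows : ∀ n {A : Matrix n} i j → i ≢ j → (∀ c → A i c ≡ A j c) → det A ≡ 0ℤ
  det-equal-rows n zero zero i≢j Ai≗Aj = contradiction refl i≢j
  det-equal-rows (suc n) {A} zero (suc j) i≢j Ai≗Aj =
    det-first-row-repeated (equal-rows⇒isAlternating (det-equal-rows n)) {A} j Ai≗Aj
  det-equal-rows (suc n) {A} (suc i) zero i≢j Ai≗Aj =
    det-first-row-repeated (equal-rows⇒isAlternating (det-equal-rows n)) {A} i (sym ∘ Ai≗Aj)
  det-equal-rows (suc n) {A} (suc i) (suc j) i≢j Ai≗Aj =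
    sum-zero (λ c → -1ℤ ^ toℕ c * A zero c * det (minor A c)) λ c → trans
      (cong (-1ℤ ^ toℕ c * A zero c *_)
        (det-equal-rows n {minor A c} i j (i≢j ∘ cong suc) (Ai≗Aj ∘ punchIn c)))
      (ℤ.*-zeroʳ (-1ℤ ^ toℕ c * A zero c))

  det-isAlternating : IsAlternating (det {n})
  det-isAlternating {n} = equal-rows⇒isAlternating (det-equal-rows n)

  -- Uniqueness of alternating forms.

  δ : Matrix n
  δ zero    zero    = 1ℤ
  δ zero    (suc j) = 0ℤ
  δ (suc i) zero    = 0ℤ
  δ (suc i) (suc j) = δ i j

  δ-diagonal : ∀ (i : Fin n) → δ i i ≡ 1ℤ
  δ-diagonal zero    = refl
  δ-diagonal (suc i) = δ-diagonal i

  δ-off-diagonal : ∀ (i j : Fin n) → i ≢ j → δ i j ≡ 0ℤ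
  δ-off-diagonal zero    zero    i≢j = contradiction refl i≢j
  δ-off-diagonal zero    (suc j) i≢j = refl
  δ-off-diagonal (suc i) zero    i≢j = refl
  δ-off-diagonal (suc i) (suc j) i≢j = δ-off-diagonal i j (i≢j ∘ cong suc)

  δ-sym : ∀ (i j : Fin n) → δ i j ≡ δ j i
  δ-sym zero    zero    = refl
  δ-sym zero    (suc j) = refl
  δ-sym (suc i) zero    = refl
  δ-sym (suc i) (suc j) = δ-sym i j

  sum-δ : ∀ (x : Vector ℤ n) c → sum (λ j → x j * δ j c) ≡ x c
  sum-δ {suc n} x zero = begin
    x zero * 1ℤ + sum (λ j → x (suc j) * 0ℤ)
      ≡⟨ cong₂ _+_ (ℤ.*-identityʳ (x zero))
                   (sum-zero (λ j → x (suc j) * 0ℤ) λ j → ℤ.*-zeroʳ (x (suc j))) ⟩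
    x zero + 0ℤ                              ≡⟨ ℤ.+-identityʳ (x zero) ⟩
    x zero                                   ∎
  sum-δ {suc n} x (suc c) = begin
    x zero * 0ℤ + sum (λ j → x (suc j) * δ j c)
      ≡⟨ cong₂ _+_ (ℤ.*-zeroʳ (x zero)) (sum-δ (x ∘ suc) c) ⟩
    0ℤ + x (suc c)                           ≡⟨ ℤ.+-identityˡ (x (suc c)) ⟩
    x (suc c)                                ∎

  -- The identity with row `j` carried to the top and the other rows in order: the matrix of a cycle
  -- of length j + 1, whence the sign (-1)^j.
  δ-moved : Fin (suc n) → Matrix (suc n)
  δ-moved j zero    = δ j
  δ-moved j (suc r) = δ (punchIn j r)

  punchIn-inject₁ : ∀ (j : Fin n) → punchIn (inject₁ j) j ≡ suc j
  punchIn-inject₁ zero    = refl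
  punchIn-inject₁ (suc j) = cong suc (punchIn-inject₁ j)

  punchIn-suc : ∀ (j : Fin n) → punchIn (suc j) j ≡ inject₁ j
  punchIn-suc zero    = refl
  punchIn-suc (suc j) = cong suc (punchIn-suc j)

  punchIn-inject₁-suc : ∀ (j r : Fin n) → r ≢ j → punchIn (suc j) r ≡ punchIn (inject₁ j) r
  punchIn-inject₁-suc zero    zero    r≢j = contradiction refl r≢j
  punchIn-inject₁-suc zero    (suc r) r≢j = refl
  punchIn-inject₁-suc (suc j) zero    r≢j = refl
  punchIn-inject₁-suc (suc j) (suc r) r≢j =
    cong suc (punchIn-inject₁-suc j r (r≢j ∘ cong suc))

  -- Consequently an identity matrix padded with a zero column `j` and topped by `δ j` is
  -- `δ-moved j`.
  insertAt-δ : ∀ (j : Fin (suc n)) r c → insertAt (δ r) j 0ℤ c ≡ δ (punchIn j r) c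
  insertAt-δ zero          r       zero    = refl
  insertAt-δ zero          r       (suc c) = refl
  insertAt-δ (suc j) zero    zero    = refl
  insertAt-δ (suc j) (suc r) zero    = refl
  insertAt-δ (suc j) zero    (suc c) = insertAt-0 j c
    where
    insertAt-0 : ∀ {n} (j : Fin (suc n)) c → insertAt (λ _ → 0ℤ) j 0ℤ c ≡ 0ℤ
    insertAt-0         zero    zero    = refl
    insertAt-0         zero    (suc c) = refl
    insertAt-0 {suc n} (suc j) zero    = refl
    insertAt-0 {suc n} (suc j) (suc c) = insertAt-0 j c
  insertAt-δ (suc j) (suc r) (suc c) = insertAt-δ j r c

  -- Written as padding by a zero so that cleared rows are visibly the padded rows of a minor;
  -- `clear-≗` recognises it as adding a multiple of `δ j`.
  clear : Fin (suc n) → Vector ℤ (suc n) → Vector ℤ (suc n)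
  clear j v = insertAt (v ∘ punchIn j) j 0ℤ

  clear-≗ : ∀ (j : Fin (suc n)) v c → clear j v c ≡ v c + - v j * δ j c
  clear-≗ zero v zero = cancel (v zero)
    where
    cancel : ∀ x → 0ℤ ≡ x + - x * 1ℤ
    cancel = solve-∀
  clear-≗ zero v (suc c) = add-zero (v (suc c)) (v zero)
    where
    add-zero : ∀ x y → x ≡ x + - y * 0ℤ
    add-zero = solve-∀
  clear-≗ {suc n} (suc j) v zero = add-zero (v zero) (v (suc j))
    where
    add-zero : ∀ x y → x ≡ x + - y * 0ℤ
    add-zero = solve-∀
  clear-≗ {suc n} (suc j) v (suc c) = clear-≗ j (v ∘ suc) c

  -- The rows can be changed one at a time: a row that has been changed is absorbed into `g`, and
  -- the induction deals with the rest.
  rowwise : ∀ {m} (g : (Fin m → Vector ℤ n) → ℤ) (Φ : Vector ℤ n → Vector ℤ n) →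
            (∀ {A B} → A ≈ₘ B → g A ≡ g B) →
            (∀ r T → g (T [ r ≔ Φ (T r) ]) ≡ g T) → ∀ T → g (Φ ∘ T) ≡ g T
  rowwise {m = zero}  g Φ g-resp g-step T = g-resp λ ()
  rowwise {m = suc m} g Φ g-resp g-step T = begin
    g (Φ ∘ T)                          ≡⟨ g-resp (λ { zero _ → refl ; (suc r) _ → refl }) ⟩
    g (Φ (T zero) ∷ Φ ∘ T ∘ suc)       ≡⟨ rowwise (λ U → g (Φ (T zero) ∷ U)) Φ
                                            (λ A≈B → g-resp λ { zero _ → refl ; (suc r) → A≈B r })
                                            (λ r U → trans
                                              (g-resp λ { zero _ → refl ; (suc r) _ → refl })
                                              (g-step (suc r) (Φ (T zero) ∷ U)))
                                            (T ∘ suc) ⟩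
    g (Φ (T zero) ∷ T ∘ suc)           ≡⟨ g-resp (λ { zero _ → refl ; (suc r) _ → refl }) ⟩
    g (T [ zero ≔ Φ (T zero) ])        ≡⟨ g-step zero T ⟩
    g T                                ∎

  module _ {f : Matrix (suc n) → ℤ} (isAlt : IsAlternating f) where
    open IsAlternating isAlt

    -- δ-moved (suc j) arises from δ-moved (inject₁ j) by exchanging rows zero and suc j.
    alternating-δ-moved : ∀ j → f (δ-moved j) ≡ -1ℤ ^ toℕ j * f δ
    alternating-δ-moved = <-weakInduction (λ j → f (δ-moved j) ≡ -1ℤ ^ toℕ j * f δ)
      (trans (respects λ { zero _ → refl ; (suc r) _ → refl }) (sym (ℤ.*-identityˡ (f δ))))
      λ j IH → begin
        f (δ-moved (suc j))                ≡⟨ antisymmetric zero (suc j) (λ ())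
                                               (cong-app (cong δ (sym (punchIn-inject₁ j))))
                                               (cong-app (cong δ (punchIn-suc j)))
                                               (others j) ⟩
        - f (δ-moved (inject₁ j))          ≡⟨ cong -_ IH ⟩
        - (-1ℤ ^ toℕ (inject₁ j) * f δ)    ≡⟨ cong (λ t → - (-1ℤ ^ t * f δ)) (toℕ-inject₁ j) ⟩
        - (-1ℤ ^ toℕ j * f δ)              ≡⟨ pull-neg (-1ℤ ^ toℕ j) (f δ) ⟩
        -1ℤ * -1ℤ ^ toℕ j * f δ            ∎
      where
      pull-neg : ∀ x y → - (x * y) ≡ -1ℤ * x * y
      pull-neg = solve-∀

      others : ∀ j r → r ≢ zero → r ≢ suc j → ∀ c →
               δ-moved (suc j) r c ≡ δ-moved (inject₁ j) r c
      others j zero    r≢0 r≢j c = contradiction refl r≢0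
      others j (suc r) r≢0 r≢j c =
        cong-app (cong δ (punchIn-inject₁-suc j r (r≢j ∘ cong suc))) c

    alternating-sum-row : ∀ {m} (x : Vector ℤ m) (v : Fin m → Vector ℤ (suc n)) T →
      f ((λ c → sum λ j → x j * v j c) ∷ T) ≡ sum λ j → x j * f (v j ∷ T)
    alternating-sum-row {zero} x v T =
      -- A zero row is 0 times itself plus 0 times itself, so linearity with both coefficients 0
      -- yields the empty sum.
      linear zero 0ℤ 0ℤ {A = Z} {B = Z} {C = Z} (λ _ _ _ → refl) (λ _ _ _ → refl) (λ _ → refl)
      where
      Z = (λ c → 0ℤ) ∷ T
    alternating-sum-row {suc m} x v T = begin
      f ((λ c → x zero * v zero c + sum (λ j → x (suc j) * v (suc j) c)) ∷ T)
        ≡⟨ linear zero (x zero) 1ℤ {A = v zero ∷ T} {B = R ∷ T} off off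
             (λ c → cong (_+_ (x zero * v zero c)) (sym (ℤ.*-identityˡ (R c)))) ⟩
      x zero * f (v zero ∷ T) + 1ℤ * f (R ∷ T)
        ≡⟨ cong (_+_ (x zero * f (v zero ∷ T)))
             (trans (ℤ.*-identityˡ (f (R ∷ T))) (alternating-sum-row (x ∘ suc) (v ∘ suc) T)) ⟩
      x zero * f (v zero ∷ T) + sum (λ j → x (suc j) * f (v (suc j) ∷ T)) ∎
      where
      R : Vector ℤ (suc n)
      R c = sum λ j → x (suc j) * v (suc j) c

      off : ∀ {u w : Vector ℤ (suc n)} r → r ≢ zero → ∀ c → (u ∷ T) r c ≡ (w ∷ T) r c
      off zero    r≢0 c = contradiction refl r≢0
      off (suc r) r≢0 c = refl

    alternating-expansion : ∀ A → f A ≡ sum λ j → A zero j * f (δ j ∷ A ∘ suc)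
    alternating-expansion A = trans
      (respects λ { zero c → sym (sum-δ (A zero) c) ; (suc r) c → refl })
      (alternating-sum-row (A zero) δ (A ∘ suc))

    -- Multiples of the top row `δ j` remove column `j` from all rows below it; after that only the
    -- minor matters.
    alternating-clear : ∀ j T → f (δ j ∷ clear j ∘ T) ≡ f (δ j ∷ T)
    alternating-clear j = rowwise (λ U → f (δ j ∷ U)) (clear j)
      (λ A≈B → respects λ { zero _ → refl ; (suc r) → A≈B r })
      λ r T → add-multiple (suc r) zero (- T r j) (λ ()) (off r T) λ c → begin
        (T [ r ≔ clear j (T r) ]) r c      ≡⟨ cong-app (updateAt-updates r T) c ⟩
        clear j (T r) c                    ≡⟨ clear-≗ j (T r) c ⟩
        T r c + - T r j * δ j c            ∎
      where
      off : ∀ r T i → i ≢ suc r → ∀ c →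
            (δ j ∷ (T [ r ≔ clear j (T r) ])) i c ≡ (δ j ∷ T) i c
      off r T zero    i≢r c = refl
      off r T (suc i) i≢r c = cong-app (updateAt-minimal i r T (i≢r ∘ cong suc)) c

    -- Lets the induction in `alternating-unique` be applied to the form that `f` induces on minors.
    minor-isAlternating : ∀ j → IsAlternating λ B → f (δ j ∷ λ r → insertAt (B r) j 0ℤ)
    minor-isAlternating j = record
      { respects    = λ A≈B → respects λ { zero c → refl ; (suc r) → ins-cong (A≈B r) }
      ; linear      = λ i s t A≗ B≗ Ci → linear (suc i) s t
          (λ { zero _ c → refl ; (suc r) r≢i → ins-cong (A≗ r (r≢i ∘ cong suc)) })
          (λ { zero _ c → refl ; (suc r) r≢i → ins-cong (B≗ r (r≢i ∘ cong suc)) })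
          (ins-linear s t Ci)
      ; alternating = λ i k i≢k Ai≗Ak → alternating (suc i) (suc k)
          (i≢k ∘ suc-injective) (ins-cong Ai≗Ak)
      }
      where
      ins : Vector ℤ n → Vector ℤ (suc n)
      ins v = insertAt v j 0ℤ

      on-punchIn : ∀ {P : Fin (suc n) → Set} → P j → (∀ c → P (punchIn j c)) → ∀ c → P c
      on-punchIn {P} Pj P-in c with j ≟ c
      ... | yes refl = Pj
      ... | no  j≢c  = subst P (punchIn-punchOut j≢c) (P-in (punchOut j≢c))

      ins-linear : ∀ s t {u v w : Vector ℤ n} → (∀ c → w c ≡ s * u c + t * v c) →
                   ∀ c → ins w c ≡ s * ins u c + t * ins v c
      ins-linear s t {u} {v} {w} w≗ = on-punchIn
        (begin
          ins w j                        ≡⟨ insertAt-lookup w j 0ℤ ⟩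
          0ℤ                             ≡⟨ vanish s t ⟩
          s * 0ℤ + t * 0ℤ                ≡⟨ cong₂ (λ x y → s * x + t * y) (insertAt-lookup u j 0ℤ)
                                                                          (insertAt-lookup v j 0ℤ) ⟨
          s * ins u j + t * ins v j      ∎)
        λ c → begin
          ins w (punchIn j c)            ≡⟨ insertAt-punchIn w j 0ℤ c ⟩
          w c                            ≡⟨ w≗ c ⟩
          s * u c + t * v c
            ≡⟨ cong₂ (λ x y → s * x + t * y) (insertAt-punchIn u j 0ℤ c)
                (insertAt-punchIn v j 0ℤ c) ⟨
          s * ins u (punchIn j c) + t * ins v (punchIn j c) ∎
        where
        vanish : ∀ s t → 0ℤ ≡ s * 0ℤ + t * 0ℤ
        vanish = solve-∀

      ins-cong : ∀ {u v : Vector ℤ n} → (∀ c → u c ≡ v c) → ∀ c → ins u c ≡ ins v c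
      ins-cong {u} {v} u≗v = on-punchIn
        (trans (insertAt-lookup u j 0ℤ) (sym (insertAt-lookup v j 0ℤ)))
        λ c → trans (insertAt-punchIn u j 0ℤ c)
                (trans (u≗v c) (sym (insertAt-punchIn v j 0ℤ c)))

  -- Writing the top row in unit vectors and clearing column `j` reduces each term to a minor. By
  -- induction that minor contributes its determinant, and the remaining factor `f (δ-moved j)`
  -- contributes the sign (-1)^j: together these are the terms of the Laplace expansion.
  alternating-unique : ∀ n {f : Matrix n → ℤ} → IsAlternating f → ∀ A → f A ≡ det A * f δ
  alternating-unique zero {f} isAlt A =
    trans (IsAlternating.respects isAlt λ ()) (sym (ℤ.*-identityˡ (f δ)))
  alternating-unique (suc n) {f} isAlt A = begin
    f A                                                   ≡⟨ alternating-expansion isAlt A ⟩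
    sum (λ j → A zero j * f (δ j ∷ A ∘ suc))              ≡⟨ sum-cong-≗ term ⟩
    sum (λ j → -1ℤ ^ toℕ j * A zero j * det (minor A j) * f δ)
      ≡⟨ *-distribʳ-sum (f δ) (λ j → -1ℤ ^ toℕ j * A zero j * det (minor A j)) ⟨
    det A * f δ                                           ∎
    where
    rearrange : ∀ a d e x → a * (d * (e * x)) ≡ e * a * d * x
    rearrange = solve-∀

    term : ∀ j → A zero j * f (δ j ∷ A ∘ suc) ≡ -1ℤ ^ toℕ j * A zero j * det (minor A j) * f δ
    term j = begin
      A zero j * f (δ j ∷ A ∘ suc)
        ≡⟨ cong (A zero j *_) (alternating-clear isAlt j (A ∘ suc)) ⟨
      A zero j * f (δ j ∷ λ r → insertAt (minor A j r) j 0ℤ)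
        ≡⟨ cong (A zero j *_) (alternating-unique n (minor-isAlternating isAlt j) (minor A j)) ⟩
      A zero j * (det (minor A j) * f (δ j ∷ λ r → insertAt (δ r) j 0ℤ))
        ≡⟨ cong (λ x → A zero j * (det (minor A j) * x))
             (trans (IsAlternating.respects isAlt
                      λ { zero c → refl ; (suc r) c → insertAt-δ j r c })
                    (alternating-δ-moved isAlt j)) ⟩
      A zero j * (det (minor A j) * (-1ℤ ^ toℕ j * f δ))
        ≡⟨ rearrange (A zero j) (det (minor A j)) (-1ℤ ^ toℕ j) (f δ) ⟩
      -1ℤ ^ toℕ j * A zero j * det (minor A j) * f δ ∎

  -- Multiplicativity of the determinant.

  infixl 7 _*ₘ_

  _*ₘ_ : Matrix n → Matrix n → Matrix n
  (A *ₘ B) i j = sum λ l → A i l * B l j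

  -- Row `i` of the product depends on row `i` of `A` alone, and linearly.
  *ₘ-isAlternating : ∀ (B : Matrix n) → IsAlternating λ A → det (A *ₘ B)
  *ₘ-isAlternating {n} B = record
    { respects    = λ A≈A′ → respects λ i → row (A≈A′ i)
    ; linear      = λ i s t A≗ B≗ Ci → linear i s t
        (λ r r≢i → row (A≗ r r≢i)) (λ r r≢i → row (B≗ r r≢i)) (row-linear s t Ci)
    ; alternating = λ i j i≢j Ai≗Aj → alternating i j i≢j (row Ai≗Aj)
    }
    where
    open IsAlternating (det-isAlternating {n})

    row : ∀ {u v : Vector ℤ n} → (∀ c → u c ≡ v c) →
          ∀ c → sum (λ l → u l * B l c) ≡ sum (λ l → v l * B l c)
    row u≗v c = sum-cong-≗ λ l → cong (_* B l c) (u≗v l)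

    row-linear : ∀ s t {u v w : Vector ℤ n} → (∀ c → w c ≡ s * u c + t * v c) → ∀ c →
                 sum (λ l → w l * B l c) ≡ s * sum (λ l → u l * B l c) + t * sum (λ l → v l * B l c)
    row-linear s t {u} {v} {w} w≗ c =
      sum-linear s t (λ l → u l * B l c) (λ l → v l * B l c) (λ l → w l * B l c) λ l →
        trans (cong (_* B l c) (w≗ l)) (distribute s t (u l) (v l) (B l c))
      where
      distribute : ∀ s t x y b → (s * x + t * y) * b ≡ s * (x * b) + t * (y * b)
      distribute = solve-∀

  -- The left side is an alternating form in `A` whose value at the identity is `det B`, so
  -- uniqueness applies.
  det-*ₘ : ∀ (A B : Matrix n) → det (A *ₘ B) ≡ det A * det B
  det-*ₘ {n} A B = trans (alternating-unique n (*ₘ-isAlternating B) A)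
    (cong (det A *_) (det-respects λ i j → begin
      sum (λ l → δ i l * B l j)   ≡⟨ sum-cong-≗
          (λ l → trans (cong (_* B l j) (δ-sym i l)) (ℤ.*-comm (δ l i) (B l j))) ⟩
      sum (λ l → B l j * δ l i)   ≡⟨ sum-δ (λ l → B l j) i ⟩
      B i j                       ∎))

  diagonal : Vector ℤ n → Matrix n
  diagonal d i j = d i * δ i j

  prod : Vector ℤ n → ℤ
  prod = foldr _*_ 1ℤ

  det-diagonal : ∀ (d : Vector ℤ n) → det (diagonal d) ≡ prod d
  det-diagonal {zero}  d = refl
  det-diagonal {suc n} d = begin
    1ℤ * (d zero * 1ℤ) * det (diagonal (d ∘ suc))
      + sum (λ j → -1ℤ ^ suc (toℕ j) * (d zero * 0ℤ) * det (minor (diagonal d) (suc j)))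
      ≡⟨ cong₂ _+_ (simplify (d zero) (det (diagonal (d ∘ suc))))
           (sum-zero (λ j → -1ℤ ^ suc (toℕ j) * (d zero * 0ℤ) * det (minor (diagonal d) (suc j)))
             λ j → vanish (-1ℤ ^ suc (toℕ j)) (d zero) (det (minor (diagonal d) (suc j)))) ⟩
    d zero * det (diagonal (d ∘ suc)) + 0ℤ
      ≡⟨ ℤ.+-identityʳ (d zero * det (diagonal (d ∘ suc))) ⟩
    d zero * det (diagonal (d ∘ suc))
      ≡⟨ cong (d zero *_) (det-diagonal (d ∘ suc)) ⟩
    d zero * prod (d ∘ suc) ∎
    where
    simplify : ∀ x y → 1ℤ * (x * 1ℤ) * y ≡ x * y
    simplify = solve-∀

    vanish : ∀ e x y → e * (x * 0ℤ) * y ≡ 0ℤ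
    vanish = solve-∀

module Congruences where
  open Determinants
  import Algebra.Properties.Semiring.Sum as SemiringSum
  open import Data.Fin.Base using (Fin; zero; suc; toℕ; punchIn; punchOut; inject₁; fromℕ; fromℕ<)
  open import Data.Fin.Properties
    using (_≟_; toℕ-inject₁; toℕ-fromℕ; punchIn-punchOut; punchInᵢ≢i; toℕ<n; toℕ-fromℕ<)
  open import Data.Integer.Base as ℤ using (ℤ; -_; 0ℤ; 1ℤ; -1ℤ; _+_; _*_; _-_; _^_)
  open import Data.Integer.DivMod using (a≡a%ℕn+[a/ℕn]*n; _%ℕ_; _/ℕ_)
  import Data.Integer.Divisibility as Unsigned
  open import Data.Integer.Divisibility.Signed using (divides; ∣ᵤ⇒∣; ∣⇒∣ᵤ)
  import Data.Integer.Properties as ℤ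
  open import Data.Integer.Tactic.RingSolver using (solve-∀)
  open import Data.Nat.Base as ℕ using (ℕ; zero; suc; _∸_; _≤_; _<_; z≤n; s≤s)
  open import Data.Nat.Combinatorics using (_C_; nCk+nC[k+1]≡[n+1]C[k+1]; k>n⇒nCk≡0; nCn≡1; nCk≡nC[n∸k])
  import Data.Nat.Divisibility as ℕ
  open import Data.Nat.Primality using (Prime; euclidsLemma; prime⇒nonZero; ¬prime[0]; ¬prime[1])
  import Data.Nat.Properties as ℕ
  import Data.Nat.Tactic.RingSolver as ℕRing
  open import Data.Product.Base using (∃; _×_; _,_)
  open import Data.Sum.Base using (_⊎_; inj₁; inj₂)
  open import Data.Vec.Functional using (Vector)
  open import Function.Base using (_∘_)
  open import Function.Bundles using (_⇔_; mk⇔; Equivalence)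
  open import Relation.Binary.Bundles using (Setoid)
  open import Relation.Binary.PropositionalEquality
  import Relation.Binary.Reasoning.Setoid as SetoidReasoning
  open import Relation.Nullary.Decidable.Core using (yes; no)
  open import Relation.Nullary.Negation.Core using (¬_; contradiction)
  open SemiringSum ℤ.+-*-semiring
    using (sum; sum-cong-≗; sum-init-last; *-distribˡ-sum; ∑-distrib-+)

  private
    variable
      n : ℕ

  -- Binomial expansions and binomial coefficients.

  Σ< : ℕ → (ℕ → ℤ) → ℤ
  Σ< n f = sum {n} (f ∘ toℕ)

  Σ<-linear : ∀ n s t (f g h : ℕ → ℤ) → (∀ i → h i ≡ s * f i + t * g i) →
              Σ< n h ≡ s * Σ< n f + t * Σ< n g
  Σ<-linear n s t f g h h≗ = sum-linear {n} s t (f ∘ toℕ) (g ∘ toℕ) (h ∘ toℕ) (h≗ ∘ toℕ)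

  Σ<-+ : ∀ m n (f : ℕ → ℤ) → Σ< (m ℕ.+ n) f ≡ Σ< m f + Σ< n (λ i → f (m ℕ.+ i))
  Σ<-+ zero    n f = sym (ℤ.+-identityˡ (Σ< n f))
  Σ<-+ (suc m) n f = trans (cong (f 0 +_) (Σ<-+ m n (f ∘ suc)))
    (sym (ℤ.+-assoc (f 0) (Σ< m (f ∘ suc)) (Σ< n λ i → f (suc m ℕ.+ i))))

  ^-distribʳ-* : ∀ x y n → (x * y) ^ n ≡ x ^ n * y ^ n
  ^-distribʳ-* x y zero    = refl
  ^-distribʳ-* x y (suc n) = trans (cong (x * y *_) (^-distribʳ-* x y n))
                                   (interchange x y (x ^ n) (y ^ n))
    where
    interchange : ∀ a b c d → a * b * (c * d) ≡ a * c * (b * d)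
    interchange = solve-∀

  module _ (x y : ℤ) where

    binomialTerm : ℕ → ℕ → ℤ
    binomialTerm n r = ℤ.+ (n C r) * (x ^ (n ∸ r) * y ^ r)

    private
      pascal : ∀ n r → binomialTerm (suc n) (suc r)
                       ≡ x * binomialTerm n (suc r) + y * binomialTerm n r
      pascal n r = begin
        ℤ.+ (suc n C suc r) * (x ^ (n ∸ r) * (y * y ^ r))
          ≡⟨ cong (λ c → ℤ.+ c * (x ^ (n ∸ r) * (y * y ^ r))) (nCk+nC[k+1]≡[n+1]C[k+1] n r) ⟨
        ℤ.+ (n C r ℕ.+ n C suc r) * (x ^ (n ∸ r) * (y * y ^ r))
          ≡⟨ cong (_* (x ^ (n ∸ r) * (y * y ^ r))) (ℤ.pos-+ (n C r) (n C suc r)) ⟩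
        (ℤ.+ (n C r) + ℤ.+ (n C suc r)) * (x ^ (n ∸ r) * (y * y ^ r))
          ≡⟨ distribute (ℤ.+ (n C r)) (ℤ.+ (n C suc r)) (x ^ (n ∸ r)) y (y ^ r) ⟩
        ℤ.+ (n C suc r) * x ^ (n ∸ r) * (y * y ^ r) + y * binomialTerm n r
          ≡⟨ cong (λ z → z * (y * y ^ r) + y * binomialTerm n r) lower ⟩
        ℤ.+ (n C suc r) * (x * x ^ (n ∸ suc r)) * (y * y ^ r) + y * binomialTerm n r
          ≡⟨ cong (_+ y * binomialTerm n r)
               (rearrange (ℤ.+ (n C suc r)) x (x ^ (n ∸ suc r)) (y * y ^ r)) ⟩
        x * binomialTerm n (suc r) + y * binomialTerm n r ∎
        where
        open ≡-Reasoning

        distribute : ∀ a b u y v → (a + b) * (u * (y * v)) ≡ b * u * (y * v) + y * (a * (u * v))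
        distribute = solve-∀

        rearrange : ∀ a x u v → a * (x * u) * v ≡ x * (a * (u * v))
        rearrange = solve-∀

        -- With truncated subtraction n ∸ r = 1 + (n ∸ suc r) fails for n ≤ r, but there C(n, r + 1)
        -- is 0.
        lower : ℤ.+ (n C suc r) * x ^ (n ∸ r) ≡ ℤ.+ (n C suc r) * (x * x ^ (n ∸ suc r))
        lower with suc r ℕ.≤? n
        ... | yes r<n = cong (λ e → ℤ.+ (n C suc r) * x ^ e) (ℕ.+-∸-assoc 1 r<n)
        ... | no  r≮n = trans (cong (λ c → ℤ.+ c * x ^ (n ∸ r)) nC≡0)
                         (sym (cong (λ c → ℤ.+ c * (x * x ^ (n ∸ suc r))) nC≡0))
          where
          nC≡0 : n C suc r ≡ 0
          nC≡0 = k>n⇒nCk≡0 (ℕ.≰⇒> r≮n)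

    -- The terms with n < r vanish, so any number K > n of terms will do.
    binomial-theorem : ∀ n K → n < K → (x + y) ^ n ≡ Σ< K (binomialTerm n)
    binomial-theorem zero (suc K) n<K = sym (cong (1ℤ +_)
      (sum-zero {K} (binomialTerm 0 ∘ suc ∘ toℕ) λ i →
      trans (cong (λ c → ℤ.+ c * (1ℤ * y ^ suc (toℕ i))) (k>n⇒nCk≡0 {0} {suc (toℕ i)} (s≤s z≤n)))
            (ℤ.*-zeroˡ (1ℤ * y ^ suc (toℕ i)))))
    binomial-theorem (suc n) (suc K) (s≤s n<K) = begin
      (x + y) * (x + y) ^ n
        ≡⟨ ℤ.*-distribʳ-+ ((x + y) ^ n) x y ⟩
      x * (x + y) ^ n + y * (x + y) ^ n
        ≡⟨ cong₂ (λ s t → x * s + y * t) (binomial-theorem n (suc K) (ℕ.m<n⇒m<1+n n<K))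
                                         (binomial-theorem n K n<K) ⟩
      x * (ℤ.+ (n C 0) * (x ^ n * 1ℤ) + Σ< K (binomialTerm n ∘ suc)) + y * Σ< K (binomialTerm n)
        ≡⟨ rearrange x (x ^ n) (Σ< K (binomialTerm n ∘ suc)) (y * Σ< K (binomialTerm n)) ⟩
      1ℤ * (x ^ suc n * 1ℤ) + (x * Σ< K (binomialTerm n ∘ suc) + y * Σ< K (binomialTerm n))
        ≡⟨ cong (1ℤ * (x ^ suc n * 1ℤ) +_)
             (Σ<-linear K x y (binomialTerm n ∘ suc) (binomialTerm n) (binomialTerm (suc n) ∘ suc)
                 (pascal n)) ⟨
      1ℤ * (x ^ suc n * 1ℤ) + Σ< K (binomialTerm (suc n) ∘ suc) ∎
      where
      open ≡-Reasoning

      rearrange : ∀ x u s t → x * (1ℤ * (u * 1ℤ) + s) + t ≡ 1ℤ * (x * u * 1ℤ) + (x * s + t)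
      rearrange = solve-∀

  C-absorb : ∀ n k → suc k ℕ.* (suc n C suc k) ≡ suc n ℕ.* (n C k)
  C-absorb zero    zero    = refl
  C-absorb zero    (suc k) = ℕ.*-zeroʳ (suc (suc k))
  C-absorb (suc n) zero    = begin
    1 ℕ.* (suc (suc n) C 1)              ≡⟨ cong (1 ℕ.*_) (nCk+nC[k+1]≡[n+1]C[k+1] (suc n) 0) ⟨
    1 ℕ.* (1 ℕ.+ (suc n C 1))            ≡⟨ cong (λ c → 1 ℕ.+ c ℕ.+ 0)
        (trans (sym (ℕ.*-identityˡ (suc n C 1))) (C-absorb n 0)) ⟩
    1 ℕ.* (1 ℕ.+ suc n ℕ.* 1)            ≡⟨ arith n ⟩
    suc (suc n) ℕ.* 1                    ∎
    where
    open ≡-Reasoning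
    arith : ∀ n → 1 ℕ.* (1 ℕ.+ suc n ℕ.* 1) ≡ suc (suc n) ℕ.* 1
    arith = ℕRing.solve-∀
  C-absorb (suc n) (suc k) = begin
    suc (suc k) ℕ.* (suc (suc n) C suc (suc k))
      ≡⟨ cong (suc (suc k) ℕ.*_) (nCk+nC[k+1]≡[n+1]C[k+1] (suc n) (suc k)) ⟨
    suc (suc k) ℕ.* ((suc n C suc k) ℕ.+ (suc n C suc (suc k)))
      ≡⟨ expand k (suc n C suc k) (suc n C suc (suc k)) ⟩
    (suc n C suc k) ℕ.+ (suc k ℕ.* (suc n C suc k) ℕ.+ suc (suc k) ℕ.* (suc n C suc (suc k)))
      ≡⟨ cong ((suc n C suc k) ℕ.+_) (cong₂ ℕ._+_ (C-absorb n k) (C-absorb n (suc k))) ⟩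
    (suc n C suc k) ℕ.+ (suc n ℕ.* (n C k) ℕ.+ suc n ℕ.* (n C suc k))
      ≡⟨ cong ((suc n C suc k) ℕ.+_) (ℕ.*-distribˡ-+ (suc n) (n C k) (n C suc k)) ⟨
    (suc n C suc k) ℕ.+ suc n ℕ.* ((n C k) ℕ.+ (n C suc k))
      ≡⟨ cong (λ c → (suc n C suc k) ℕ.+ suc n ℕ.* c) (nCk+nC[k+1]≡[n+1]C[k+1] n k) ⟩
    suc (suc n) ℕ.* (suc n C suc k) ∎
    where
    open ≡-Reasoning
    expand : ∀ k a b → suc (suc k) ℕ.* (a ℕ.+ b) ≡ a ℕ.+ (suc k ℕ.* a ℕ.+ suc (suc k) ℕ.* b)
    expand = ℕRing.solve-∀

  -- A subtraction-free form of (k + 1) C(n, k + 1) = (n - k) C(n, k), obtained from absorption by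
  -- splitting C(n + 1, k + 1) with Pascal's rule.
  C-ratio : ∀ n k → suc k ℕ.* (n C suc k) ℕ.+ k ℕ.* (n C k) ≡ n ℕ.* (n C k)
  C-ratio n k = ℕ.+-cancelˡ-≡ (n C k) _ _ (begin
    n C k ℕ.+ (suc k ℕ.* (n C suc k) ℕ.+ k ℕ.* (n C k))   ≡⟨ collect k (n C k) (n C suc k) ⟩
    suc k ℕ.* (n C k ℕ.+ n C suc k)   ≡⟨ cong (suc k ℕ.*_) (nCk+nC[k+1]≡[n+1]C[k+1] n k) ⟩
    suc k ℕ.* (suc n C suc k)         ≡⟨ C-absorb n k ⟩
    suc n ℕ.* (n C k)                 ∎)
    where
    open ≡-Reasoning
    collect : ∀ k a b → a ℕ.+ (suc k ℕ.* b ℕ.+ k ℕ.* a) ≡ suc k ℕ.* (a ℕ.+ b)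
    collect = ℕRing.solve-∀

  -- Congruences modulo p and Fermat's little theorem.

  module Modulo (p : ℕ) where

    infix 4 _≈_ _≉_

    -- A record, unlike _≡_[mod_], lets Agda infer a and b from a ≈ b.
    record _≈_ (a b : ℤ) : Set where
      constructor congruent
      field
        quotient : ℤ
        equality : a ≡ b + quotient * ℤ.+ p

    _≉_ : ℤ → ℤ → Set
    a ≉ b = ¬ (a ≈ b)

    ≈⇔∣ : ∀ {a b} → a ≈ b ⇔ (a ≡ b [mod p ])
    ≈⇔∣ {a} {b} = mk⇔
      (λ { (congruent q eq) → ∣⇒∣ᵤ (divides q (trans (cong (_- b) eq) (cancel b (q * ℤ.+ p)))) })
      (λ p∣ → let divides q eq = ∣ᵤ⇒∣ {ℤ.+ p} {a - b} p∣ in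
              congruent q (trans (uncancel a b) (cong (b +_) eq)))
      where
      cancel : ∀ b c → b + c - b ≡ c
      cancel = solve-∀
      uncancel : ∀ a b → a ≡ b + (a - b)
      uncancel = solve-∀

    ≈0⇔∣ : ∀ {a} → a ≈ 0ℤ ⇔ (ℤ.+ p Unsigned.∣ a)
    ≈0⇔∣ {a} = mk⇔
      (λ { (congruent q eq) → ∣⇒∣ᵤ (divides q (trans eq (ℤ.+-identityˡ (q * ℤ.+ p)))) })
      (λ p∣ → let divides q eq = ∣ᵤ⇒∣ {ℤ.+ p} {a} p∣ in
              congruent q (trans eq (sym (ℤ.+-identityˡ (q * ℤ.+ p)))))

    ≈-reflexive : ∀ {a b} → a ≡ b → a ≈ b
    ≈-reflexive {a} refl = congruent 0ℤ (sym (ℤ.+-identityʳ a))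

    ≈-refl : ∀ {a} → a ≈ a
    ≈-refl = ≈-reflexive refl

    ≈-sym : ∀ {a b} → a ≈ b → b ≈ a
    ≈-sym {a} {b} (congruent q refl) = congruent (- q) (undo b q (ℤ.+ p))
      where
      undo : ∀ b q p → b ≡ b + q * p + - q * p
      undo = solve-∀

    ≈-trans : ∀ {a b c} → a ≈ b → b ≈ c → a ≈ c
    ≈-trans {c = c} (congruent q refl) (congruent r refl) = congruent (r + q) (merge c r q (ℤ.+ p))
      where
      merge : ∀ c r q p → c + r * p + q * p ≡ c + (r + q) * p
      merge = solve-∀

    ≈-setoid : Setoid _ _
    ≈-setoid = record
      { _≈_ = _≈_
      ; isEquivalence = record { refl = ≈-refl ; sym = ≈-sym ; trans = ≈-trans }
      }

    module ≈-Reasoning = SetoidReasoning ≈-setoid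

    +-cong : ∀ {a b c d} → a ≈ b → c ≈ d → a + c ≈ b + d
    +-cong {b = b} {d = d} (congruent q refl) (congruent r refl) =
      congruent (q + r) (merge b d q r (ℤ.+ p))
      where
      merge : ∀ b d q r p → b + q * p + (d + r * p) ≡ b + d + (q + r) * p
      merge = solve-∀

    *-cong : ∀ {a b c d} → a ≈ b → c ≈ d → a * c ≈ b * d
    *-cong {b = b} {d = d} (congruent q refl) (congruent r refl) =
      congruent (q * d + b * r + q * r * ℤ.+ p) (merge b d q r (ℤ.+ p))
      where
      merge : ∀ b d q r p → (b + q * p) * (d + r * p) ≡ b * d + (q * d + b * r + q * r * p) * p
      merge = solve-∀

    *-congˡ : ∀ {a b} c → a ≈ b → c * a ≈ c * b
    *-congˡ c = *-cong (≈-refl {c})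

    *-congʳ : ∀ {a b} c → a ≈ b → a * c ≈ b * c
    *-congʳ c a≈b = *-cong a≈b (≈-refl {c})

    ^-cong : ∀ {a b} n → a ≈ b → a ^ n ≈ b ^ n
    ^-cong zero    a≈b = ≈-refl
    ^-cong (suc n) a≈b = *-cong a≈b (^-cong n a≈b)

    a-b≈0⇒a≈b : ∀ {a b} → a + - b ≈ 0ℤ → a ≈ b
    a-b≈0⇒a≈b {a} {b} (congruent q eq) = congruent q
        (trans (uncancel a b) (trans (cong (b +_) eq) (cong (b +_) (ℤ.+-identityˡ (q * ℤ.+ p)))))
      where
      uncancel : ∀ a b → a ≡ b + (a + - b)
      uncancel = solve-∀

    sum-cong : {f g : Vector ℤ n} → (∀ i → f i ≈ g i) → sum f ≈ sum g
    sum-cong {n = zero}  f≈g = ≈-refl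
    sum-cong {n = suc n} f≈g = +-cong (f≈g zero) (sum-cong (f≈g ∘ suc))

    sum≈0 : {f : Vector ℤ n} → (∀ i → f i ≈ 0ℤ) → sum f ≈ 0ℤ
    sum≈0 {n = zero}  f≈0 = ≈-refl
    sum≈0 {n = suc n} f≈0 = +-cong (f≈0 zero) (sum≈0 (f≈0 ∘ suc))

    det-cong : {A B : Matrix n} → (∀ i j → A i j ≈ B i j) → det A ≈ det B
    det-cong {zero}  A≈B = ≈-refl
    det-cong {suc n} A≈B = sum-cong λ j →
      *-cong (*-congˡ (-1ℤ ^ toℕ j) (A≈B zero j))
             (det-cong λ r c → A≈B (suc r) (punchIn j c))

    prod≈0 : {f : Vector ℤ n} → ∀ i → f i ≈ 0ℤ → prod f ≈ 0ℤ
    prod≈0 {f = f} zero    fi≈0 = *-congʳ (prod (f ∘ suc)) fi≈0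
    prod≈0 {f = f} (suc i) fi≈0 =
      ≈-trans (*-congˡ (f zero) (prod≈0 i fi≈0)) (≈-reflexive (ℤ.*-zeroʳ (f zero)))

  module ModuloPrime {p : ℕ} (p-prime : Prime p) where
    open Modulo p public

    open Equivalence using (to; from)

    *≈0 : ∀ a b → a * b ≈ 0ℤ → a ≈ 0ℤ ⊎ b ≈ 0ℤ
    *≈0 a b ab≈0 with euclidsLemma ℤ.∣ a ∣ ℤ.∣ b ∣ p-prime
                        (subst (p ℕ.∣_) (ℤ.abs-* a b) (to ≈0⇔∣ ab≈0))
    ... | inj₁ p∣a = inj₁ (from ≈0⇔∣ p∣a)
    ... | inj₂ p∣b = inj₂ (from ≈0⇔∣ p∣b)

    *≉0 : ∀ {a b} → a ≉ 0ℤ → b ≉ 0ℤ → a * b ≉ 0ℤ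
    *≉0 {a} {b} a≉0 b≉0 ab≈0 with *≈0 a b ab≈0
    ... | inj₁ a≈0 = a≉0 a≈0
    ... | inj₂ b≈0 = b≉0 b≈0

    *≈0⇒ʳ : ∀ {a b} → a ≉ 0ℤ → a * b ≈ 0ℤ → b ≈ 0ℤ
    *≈0⇒ʳ {a} {b} a≉0 ab≈0 with *≈0 a b ab≈0
    ... | inj₁ a≈0 = contradiction a≈0 a≉0
    ... | inj₂ b≈0 = b≈0

    *≈0⇒ˡ : ∀ {a b} → b ≉ 0ℤ → a * b ≈ 0ℤ → a ≈ 0ℤ
    *≈0⇒ˡ {a} {b} b≉0 ab≈0 with *≈0 a b ab≈0
    ... | inj₁ a≈0 = a≈0
    ... | inj₂ b≈0 = contradiction b≈0 b≉0

    *-cancelˡ : ∀ {a b} c → c ≉ 0ℤ → c * a ≈ c * b → a ≈ b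
    *-cancelˡ {a} {b} c c≉0 ca≈cb with *≈0 c (a + - b) c[a-b]≈0
      where
      split : ∀ c a b → c * (a + - b) ≡ c * a + - 1ℤ * (c * b)
      split = solve-∀
      cancel : ∀ x → x + - 1ℤ * x ≡ 0ℤ
      cancel = solve-∀
      c[a-b]≈0 : c * (a + - b) ≈ 0ℤ
      c[a-b]≈0 = ≈-trans (≈-reflexive (split c a b))
        (≈-trans (+-cong ca≈cb (≈-refl { - 1ℤ * (c * b)})) (≈-reflexive (cancel (c * b))))
    ... | inj₁ c≈0   = contradiction c≈0 c≉0
    ... | inj₂ a-b≈0 = a-b≈0⇒a≈b a-b≈0

    1≉0 : 1ℤ ≉ 0ℤ
    1≉0 1≈0 with ℕ.∣1⇒≡1 (to ≈0⇔∣ 1≈0)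
    ... | refl = ¬prime[1] p-prime

    ^≉0 : ∀ {a} n → a ≉ 0ℤ → a ^ n ≉ 0ℤ
    ^≉0 zero    a≉0 = 1≉0
    ^≉0 {a} (suc n) a≉0 = *≉0 a≉0 (^≉0 {a} n a≉0)

    prod≉0 : {f : Vector ℤ n} → (∀ i → f i ≉ 0ℤ) → prod f ≉ 0ℤ
    prod≉0 {n = zero}  f≉0 = 1≉0
    prod≉0 {n = suc n} f≉0 = *≉0 (f≉0 zero) (prod≉0 (f≉0 ∘ suc))

    prod≈0⇒ : ∀ {n} (f : Vector ℤ n) → prod f ≈ 0ℤ → ∃ λ i → f i ≈ 0ℤ
    prod≈0⇒ {zero}  f f≈0 = contradiction f≈0 1≉0
    prod≈0⇒ {suc n} f f≈0 with *≈0 (f zero) (prod (f ∘ suc)) f≈0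
    ... | inj₁ f₀≈0 = zero , f₀≈0
    ... | inj₂ f′≈0 = let i , fi≈0 = prod≈0⇒ (f ∘ suc) f′≈0 in suc i , fi≈0

    positive-below : ∀ {a} → 0 < a → a < p → ℤ.+ a ≉ 0ℤ
    positive-below {suc a} 0<a a<p a≈0 = ℕ.<⇒≱ a<p (ℕ.∣⇒≤ (to ≈0⇔∣ a≈0))

    -- By absorption r C(p, r) = p C(p - 1, r - 1), and p does not divide r.
    C≈0 : ∀ r → 0 < r → r < p → ℤ.+ (p C r) ≈ 0ℤ
    C≈0 r@(suc _) 0<r r<p with *≈0 (ℤ.+ r) (ℤ.+ (p C r))
      (≈-trans (≈-reflexive (sym (ℤ.pos-* r (p C r)))) (from ≈0⇔∣ (divisible p r)))
      where
      divisible : ∀ p r → p ℕ.∣ r ℕ.* (p C r)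
      divisible p       zero    = ℕ._∣0 p
      divisible zero    (suc r) = ℕ.∣-reflexive
        (sym (trans (cong (suc r ℕ.*_) (k>n⇒nCk≡0 {0} {suc r} (s≤s z≤n))) (ℕ.*-zeroʳ (suc r))))
      divisible (suc q) (suc r) = subst (suc q ℕ.∣_) (sym (C-absorb q r)) (ℕ.m∣m*n (q C r))
    ... | inj₁ r≈0 = contradiction r≈0 (positive-below 0<r r<p)
    ... | inj₂ C≈0 = C≈0

    -- In (r + 1) C(n, r + 1) = (n - r) C(n, r) the factor n - r is positive and below p. So if p
    -- divided C(n, r + 1) it would divide C(n, r), and so on down to C(n, 0) = 1.
    C≉0 : ∀ n r → n < p → r ≤ n → ℤ.+ (n C r) ≉ 0ℤ
    C≉0 n zero    n<p r≤n = 1≉0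
    C≉0 n (suc r) n<p r<n C≈0 = *≉0
        (positive-below (ℕ.m<n⇒0<n∸m r<n) (ℕ.≤-<-trans (ℕ.m∸n≤m n r) n<p))
      (C≉0 n r n<p (ℕ.<⇒≤ r<n)) (begin
        ℤ.+ (n ∸ r) * ℤ.+ (n C r)            ≡⟨ ℤ.pos-* (n ∸ r) (n C r) ⟨
        ℤ.+ ((n ∸ r) ℕ.* (n C r))            ≡⟨ cong ℤ.+_ ratio ⟨
        ℤ.+ (suc r ℕ.* (n C suc r))          ≡⟨ ℤ.pos-* (suc r) (n C suc r) ⟩
        ℤ.+ suc r * ℤ.+ (n C suc r)          ≈⟨ *-congˡ (ℤ.+ suc r) C≈0 ⟩
        ℤ.+ suc r * 0ℤ                       ≡⟨ ℤ.*-zeroʳ (ℤ.+ suc r) ⟩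
        0ℤ                                   ∎)
      where
      open ≈-Reasoning
      ratio : suc r ℕ.* (n C suc r) ≡ (n ∸ r) ℕ.* (n C r)
      ratio = ℕ.+-cancelʳ-≡ (r ℕ.* (n C r)) _ _ (trans (C-ratio n r)
        (trans (cong (ℕ._* (n C r)) (sym (ℕ.m∸n+n≡m (ℕ.<⇒≤ r<n))))
            (ℕ.*-distribʳ-+ (n C r) (n ∸ r) r)))

    freshman : ∀ x → (x + 1ℤ) ^ p ≈ x ^ p + 1ℤ
    freshman x = ≈-trans (≈-reflexive (binomial-theorem x 1ℤ p (suc p) (ℕ.n<1+n p)))
        (outer p p-prime refl)
      where
      open ≈-Reasoning
      term = binomialTerm x 1ℤ p

      simplify : ∀ u → 1ℤ * (u * 1ℤ) ≡ u
      simplify = solve-∀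

      -- `n` is a copy of `p` tied to it by an equation: matching on the copy exposes the first and
      -- last terms, while `p` stays fixed in the summands.
      outer : ∀ n → Prime n → n ≡ p → Σ< (suc n) term ≈ x ^ p + 1ℤ
      outer zero    pr  eq = contradiction pr ¬prime[0]
      outer (suc q) _ eq = +-cong (≈-reflexive (simplify (x ^ p))) (begin
        Σ< (suc q) (term ∘ suc)
          ≡⟨ sum-init-last {q} (term ∘ suc ∘ toℕ) ⟩
        sum (λ (i : Fin q) → term (suc (toℕ (inject₁ i)))) + term (suc (toℕ (fromℕ q)))
          ≈⟨ +-cong (sum≈0 inner) last-term ⟩
        0ℤ + 1ℤ ≡⟨⟩
        1ℤ      ∎)
        where
        inner : ∀ (i : Fin q) → term (suc (toℕ (inject₁ i))) ≈ 0ℤ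
        inner i = *-congʳ (x ^ (p ∸ suc (toℕ (inject₁ i))) * 1ℤ ^ suc (toℕ (inject₁ i)))
          (C≈0 (suc (toℕ (inject₁ i))) (s≤s z≤n)
            (subst (suc (toℕ (inject₁ i)) <_) eq
              (s≤s (subst (_< q) (sym (toℕ-inject₁ i)) (toℕ<n i)))))

        last-term : term (suc (toℕ (fromℕ q))) ≈ 1ℤ
        last-term = ≈-reflexive (trans (cong term (trans (cong suc (toℕ-fromℕ q)) eq))
          (trans (cong₂ (λ c e → ℤ.+ c * (x ^ e * 1ℤ ^ p)) (nCn≡1 p) (ℕ.n∸n≡0 p))
                 (cong (λ z → 1ℤ * (1ℤ * z)) (ℤ.^-zeroˡ p))))

    -- Every integer is congruent to its natural remainder, and on naturals `freshman` is the
    -- induction step.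
    fermat : ∀ x → x ^ p ≈ x
    fermat x = begin
      x ^ p       ≈⟨ ^-cong p x≈r ⟩
      (ℤ.+ r) ^ p ≈⟨ natural r ⟩
      ℤ.+ r       ≈⟨ x≈r ⟨
      x           ∎
      where
      open ≈-Reasoning
      instance _ = prime⇒nonZero p-prime
      r = x %ℕ p

      x≈r : x ≈ ℤ.+ r
      x≈r = congruent (x /ℕ p) (a≡a%ℕn+[a/ℕn]*n x p)

      0^ : ∀ n → Prime n → 0ℤ ^ n ≡ 0ℤ
      0^ zero    pr = contradiction pr ¬prime[0]
      0^ (suc n) pr = refl

      natural : ∀ a → (ℤ.+ a) ^ p ≈ ℤ.+ a
      natural zero    = ≈-reflexive (0^ p p-prime)
      natural (suc a) = begin
        (ℤ.+ suc a) ^ p      ≡⟨ cong (_^ p) (ℤ.+-comm 1ℤ (ℤ.+ a)) ⟩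
        (ℤ.+ a + 1ℤ) ^ p     ≈⟨ freshman (ℤ.+ a) ⟩
        (ℤ.+ a) ^ p + 1ℤ     ≈⟨ +-cong (natural a) ≈-refl ⟩
        ℤ.+ a + 1ℤ           ≡⟨ ℤ.+-comm (ℤ.+ a) 1ℤ ⟩
        ℤ.+ suc a            ∎

    fermat-little : ∀ x → x ≉ 0ℤ → x ^ (p ∸ 1) ≈ 1ℤ
    fermat-little x x≉0 = *-cancelˡ x x≉0
      (≈-trans (≈-reflexive (cong (x ^_) (suc-pred p p-prime)))
        (≈-trans (fermat x) (≈-reflexive (sym (ℤ.*-identityʳ x)))))
      where
      suc-pred : ∀ n → Prime n → suc (n ∸ 1) ≡ n
      suc-pred zero    pr = contradiction pr ¬prime[0]
      suc-pred (suc n) pr = refl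

  -- Lagrange interpolation and Vandermonde matrices.

  polynomial-with-roots : ∀ {d} (r : Vector ℤ d) → ∃ λ (e : ℕ → ℤ) →
    ∀ K → d < K → ∀ x → Σ< K (λ b → e b * x ^ b) ≡ prod λ t → x - r t
  polynomial-with-roots {zero} r = e , λ { (suc K) d<K x → cong (1ℤ +_)
      (sum-zero {K} (λ b → 0ℤ * x ^ suc (toℕ b)) λ b → ℤ.*-zeroˡ (x ^ suc (toℕ b))) }
    where
    e : ℕ → ℤ
    e zero    = 1ℤ
    e (suc b) = 0ℤ
  polynomial-with-roots {suc d} r with polynomial-with-roots (r ∘ suc)
  ... | e , e-correct = e′ , correct
    where
    open ≡-Reasoning

    -- Multiplication by x - r zero on coefficient sequences. These are indexed by all of ℕ and are
    -- 0 above the degree; so the number `K` of terms is free, and the induction hypothesis can be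
    -- used at both `K` and `suc K`.
    e′ : ℕ → ℤ
    e′ zero    = - r zero * e zero
    e′ (suc b) = e b - r zero * e (suc b)

    shift : ∀ a b s x u → (a - s * b) * (x * u) ≡ x * (a * u) + - s * (b * (x * u))
    shift = solve-∀

    regroup : ∀ s e₀ a b → - s * e₀ * 1ℤ + (a + - s * b) ≡ a + - s * (e₀ * 1ℤ + b)
    regroup = solve-∀

    factor : ∀ x s y → x * y + - s * y ≡ (x - s) * y
    factor = solve-∀

    correct : ∀ K → suc d < K → ∀ x → Σ< K (λ b → e′ b * x ^ b) ≡ prod λ t → x - r t
    correct (suc K) (s≤s d<K) x = begin
      - r zero * e zero * 1ℤ + Σ< K (λ b → (e b - r zero * e (suc b)) * (x * x ^ b))
        ≡⟨ cong (- r zero * e zero * 1ℤ +_) (Σ<-linear K x (- r zero)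
             (λ b → e b * x ^ b) (λ b → e (suc b) * x ^ suc b)
             (λ b → (e b - r zero * e (suc b)) * (x * x ^ b))
             λ b → shift (e b) (e (suc b)) (r zero) x (x ^ b)) ⟩
      - r zero * e zero * 1ℤ
        + (x * Σ< K (λ b → e b * x ^ b) + - r zero * Σ< K (λ b → e (suc b) * x ^ suc b))
        ≡⟨ regroup (r zero) (e zero) (x * Σ< K (λ b → e b * x ^ b))
            (Σ< K (λ b → e (suc b) * x ^ suc b)) ⟩
      x * Σ< K (λ b → e b * x ^ b) + - r zero * Σ< (suc K) (λ b → e b * x ^ b)
        ≡⟨ cong₂ (λ y z → x * y + - r zero * z) (e-correct K d<K x)
            (e-correct (suc K) (ℕ.m<n⇒m<1+n d<K) x) ⟩
      x * prod (λ t → x - r (suc t)) + - r zero * prod (λ t → x - r (suc t))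
        ≡⟨ factor x (r zero) (prod λ t → x - r (suc t)) ⟩
      (x - r zero) * prod (λ t → x - r (suc t)) ∎

  -- Row `i` holds the coefficients of the Lagrange basis polynomial for the node `x i`, left
  -- without its denominator so as to stay over ℤ. The denominator is `lagrange-weight`.
  lagrange : Vector ℤ n → Matrix n
  lagrange {n = suc d} x i b = let e , _ = polynomial-with-roots (x ∘ punchIn i) in e (toℕ b)

  prod-≡0 : ∀ {n} (f : Vector ℤ n) i → f i ≡ 0ℤ → prod f ≡ 0ℤ
  prod-≡0 f zero    fi≡0 = trans (cong (_* prod (f ∘ suc)) fi≡0) (ℤ.*-zeroˡ (prod (f ∘ suc)))
  prod-≡0 f (suc i) fi≡0 = trans (cong (f zero *_) (prod-≡0 (f ∘ suc) i fi≡0)) (ℤ.*-zeroʳ (f zero))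

  lagrange-weight : Vector ℤ n → Vector ℤ n
  lagrange-weight {n = suc d} x i = prod λ t → x i - x (punchIn i t)

  lagrange-value : ∀ (x : Vector ℤ n) i j →
    sum (λ b → lagrange x i b * x j ^ toℕ b) ≡ diagonal (lagrange-weight x) i j
  lagrange-value {n = suc d} x i j =
    let _ , e-correct = polynomial-with-roots (x ∘ punchIn i) in
    trans (e-correct (suc d) (ℕ.n<1+n d) (x j)) value
    where
    value : prod (λ t → x j - x (punchIn i t)) ≡ diagonal (lagrange-weight x) i j
    value with i ≟ j
    ... | yes refl = sym (trans (cong (lagrange-weight x i *_) (δ-diagonal i))
                                (ℤ.*-identityʳ (lagrange-weight x i)))
    ... | no i≢j   = trans
      (prod-≡0 (λ t → x j - x (punchIn i t)) (punchOut i≢j)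
        (trans (cong (λ l → x j - x l) (punchIn-punchOut i≢j)) (ℤ.+-inverseʳ (x j))))
      (sym (trans (cong (lagrange-weight x i *_) (δ-off-diagonal i j i≢j))
                  (ℤ.*-zeroʳ (lagrange-weight x i))))

  module _ {p : ℕ} (p-prime : Prime p) where
    open ModuloPrime p-prime
    open Equivalence using (to; from)

    module _ (x : Vector ℤ n) (distinct : ∀ i j → x i ≈ x j → i ≡ j) where

      lagrange-weight≉0 : ∀ i → lagrange-weight x i ≉ 0ℤ
      lagrange-weight≉0 = nonzero x distinct
        where
        nonzero : ∀ {n} (x : Vector ℤ n) → (∀ i j → x i ≈ x j → i ≡ j) →
                  ∀ i → lagrange-weight x i ≉ 0ℤ
        nonzero {suc d} x distinct i = prod≉0 λ t xi-xt≈0 →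
          punchInᵢ≢i i t (sym (distinct i (punchIn i t) (a-b≈0⇒a≈b xi-xt≈0)))

      -- The Lagrange coefficients times this matrix give the diagonal matrix of weights. Each
      -- weight is a product of differences of incongruent nodes, so p does not divide the
      -- determinant of the product.
      vandermonde≉0 : det (λ b j → x j ^ toℕ b) ≉ 0ℤ
      vandermonde≉0 V≈0 = prod≉0 lagrange-weight≉0 (begin
        prod (lagrange-weight x)              ≡⟨ det-diagonal (lagrange-weight x) ⟨
        det (diagonal (lagrange-weight x))    ≡⟨ det-respects (lagrange-value x) ⟨
        det (lagrange x *ₘ V)                 ≡⟨ det-*ₘ (lagrange x) V ⟩
        det (lagrange x) * det V              ≈⟨ *-congˡ (det (lagrange x)) V≈0 ⟩
        det (lagrange x) * 0ℤ                 ≡⟨ ℤ.*-zeroʳ (det (lagrange x)) ⟩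
        0ℤ                                    ∎)
        where
        open ≈-Reasoning
        V : Matrix n
        V b j = x j ^ toℕ b

      -- Here the nodes index rows, so the transposed coefficients `Lᵀ` multiply from the right;
      -- scaling row `i` by `s i` scales the diagonal entry of the product by the same factor.
      scaled-vandermonde≉0 : (s : Vector ℤ n) → (∀ i → s i ≉ 0ℤ) →
                             det (λ i b → s i * x i ^ toℕ b) ≉ 0ℤ
      scaled-vandermonde≉0 s s≉0 V≈0 =
        prod≉0 (λ i → *≉0 (s≉0 i) (lagrange-weight≉0 i)) (begin
          prod D                    ≡⟨ det-diagonal D ⟨
          det (diagonal D)          ≡⟨ det-respects entry ⟨
          det (V *ₘ Lᵀ)             ≡⟨ det-*ₘ V Lᵀ ⟩
          det V * det Lᵀ            ≈⟨ *-congʳ (det Lᵀ) V≈0 ⟩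
          0ℤ * det Lᵀ               ≡⟨ ℤ.*-zeroˡ (det Lᵀ) ⟩
          0ℤ                        ∎)
        where
        open ≈-Reasoning
        V Lᵀ : Matrix n
        V i b = s i * x i ^ toℕ b
        Lᵀ b j = lagrange x j b

        D : Vector ℤ n
        D i = s i * lagrange-weight x i

        δ-swap : ∀ (f : Vector ℤ n) i j → f j * δ j i ≡ f i * δ i j
        δ-swap f i j with i ≟ j
        ... | yes refl = refl
        ... | no i≢j   = trans (cong (f j *_) (δ-off-diagonal j i (i≢j ∘ sym)))
          (trans (ℤ.*-zeroʳ (f j))
              (sym (trans (cong (f i *_) (δ-off-diagonal i j i≢j)) (ℤ.*-zeroʳ (f i)))))

        regroup : ∀ s y l → s * y * l ≡ s * (l * y)
        regroup = solve-∀

        entry : ∀ i j → (V *ₘ Lᵀ) i j ≡ diagonal D i j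
        entry i j = trans (sum-cong-≗ λ b → regroup (s i) (x i ^ toℕ b) (lagrange x j b))
          (trans (sym (*-distribˡ-sum (s i) (λ b → lagrange x j b * x i ^ toℕ b)))
          (trans (cong (s i *_) (trans (lagrange-value x j i) (δ-swap (lagrange-weight x) i j)))
                 (sym (ℤ.*-assoc (s i) (lagrange-weight x i) (δ i j)))))

    det-factor : (M X W : Matrix n) (c : Vector ℤ n) →
                 (∀ i j → M i j ≈ sum λ b → X i b * (c b * W b j)) →
                 det M ≈ det X * (prod c * det W)
    det-factor M X W c M≈ = begin
      det M                               ≈⟨ det-cong (λ i j → ≈-trans (M≈ i j) (≈-reflexive
                                               (sum-cong-≗ λ b → cong (X i b *_)
                                                   (sym (scale b j))))) ⟩
      det (X *ₘ (diagonal c *ₘ W))        ≡⟨ det-*ₘ X (diagonal c *ₘ W) ⟩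
      det X * det (diagonal c *ₘ W)       ≡⟨ cong (det X *_) (trans (det-*ₘ (diagonal c) W)
                                               (cong (_* det W) (det-diagonal c))) ⟩
      det X * (prod c * det W)            ∎
      where
      open ≈-Reasoning

      regroup : ∀ c d w → c * d * w ≡ w * d * c
      regroup = solve-∀

      scale : ∀ b j → (diagonal c *ₘ W) b j ≡ c b * W b j
      scale b j = trans (sum-cong-≗ λ l → trans (ℤ.*-assoc (c b) (δ b l) (W l j))
                           (cong (c b *_) (trans (cong (_* W l j) (δ-sym b l))
                               (ℤ.*-comm (δ l b) (W l j)))))
        (trans (sym (*-distribˡ-sum (c b) (λ l → W l j * δ l b)))
               (cong (c b *_) (sum-δ (λ l → W l j) b)))

    -- Divisibility of the determinant in terms of binomial coefficients.

    module _ {N m : ℕ} (-1^N≡1 : -1ℤ ^ N ≡ 1ℤ) (m<N : m < N) (m+N<p : m ℕ.+ N < p)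
             (x : Vector ℤ N) (x^N≈1 : ∀ i → x i ^ N ≈ 1ℤ)
             (distinct : ∀ i j → x i ≈ x j → i ≡ j) where
      private
        e = m ℕ.+ N

        -- Exponents b and N + b of x j coincide modulo x^N ≈ 1, and since m + N < 2 N no third one
        -- joins them. Their signs agree because (-1)^N = 1.
        coefficient : ℕ → ℤ
        coefficient b = -1ℤ ^ b * ℤ.+ ((e C b) ℕ.+ (e C (N ℕ.+ b)))

        -- An inverse of x i modulo p, since x i^N ≈ 1. It turns x i^(e - b) into x i^e times a b-th
        -- power, which makes the left factor a Vandermonde matrix in the nodes `inverse i` with row
        -- `i` scaled by x i^e.
        inverse : Vector ℤ N
        inverse i = x i ^ (N ∸ 1)

        x*inverse≈1 : ∀ i → x i * inverse i ≈ 1ℤ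
        x*inverse≈1 i = ≈-trans (≈-reflexive (cong (x i ^_) (ℕ.m+[n∸m]≡n (ℕ.≤-<-trans z≤n m<N))))
            (x^N≈1 i)

        x≉0 : ∀ i → x i ≉ 0ℤ
        x≉0 i xi≈0 = 1≉0 (≈-trans (≈-sym (x*inverse≈1 i))
          (≈-trans (*-congʳ (inverse i) xi≈0) (≈-reflexive (ℤ.*-zeroˡ (inverse i)))))

        inverse-distinct : ∀ i j → inverse i ≈ inverse j → i ≡ j
        inverse-distinct i j i≈j = distinct i j (begin
          x i                          ≡⟨ ℤ.*-identityʳ (x i) ⟨
          x i * 1ℤ                     ≈⟨ *-congˡ (x i) (x*inverse≈1 j) ⟨
          x i * (x j * inverse j)      ≈⟨ *-congˡ (x i) (*-congˡ (x j) i≈j) ⟨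
          x i * (x j * inverse i)      ≡⟨ regroup (x i) (x j) (inverse i) ⟩
          x j * (x i * inverse i)      ≈⟨ *-congˡ (x j) (x*inverse≈1 i) ⟩
          x j * 1ℤ                     ≡⟨ ℤ.*-identityʳ (x j) ⟩
          x j                          ∎)
          where
          open ≈-Reasoning
          regroup : ∀ a b c → a * (b * c) ≡ b * (a * c)
          regroup = solve-∀

        lower-power : ∀ i {b k} → b ≤ k → x i ^ (k ∸ b) ≈ x i ^ k * inverse i ^ b
        lower-power i {b} {k} b≤k = ≈-sym (begin
          x i ^ k * y ^ b                         ≡⟨ cong (λ t → x i ^ t * y ^ b) (ℕ.m∸n+n≡m b≤k) ⟨
          x i ^ (k ∸ b ℕ.+ b) * y ^ b             ≡⟨ cong (_* y ^ b)
              (ℤ.^-distribˡ-+-* (x i) (k ∸ b) b) ⟩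
          x i ^ (k ∸ b) * x i ^ b * y ^ b         ≡⟨ ℤ.*-assoc (x i ^ (k ∸ b)) (x i ^ b) (y ^ b) ⟩
          x i ^ (k ∸ b) * (x i ^ b * y ^ b)       ≡⟨ cong (x i ^ (k ∸ b) *_)
              (^-distribʳ-* (x i) y b) ⟨
          x i ^ (k ∸ b) * (x i * y) ^ b           ≈⟨ *-congˡ (x i ^ (k ∸ b))
              (^-cong b (x*inverse≈1 i)) ⟩
          x i ^ (k ∸ b) * 1ℤ ^ b                  ≡⟨ cong (x i ^ (k ∸ b) *_) (ℤ.^-zeroˡ b) ⟩
          x i ^ (k ∸ b) * 1ℤ                      ≡⟨ ℤ.*-identityʳ (x i ^ (k ∸ b)) ⟩
          x i ^ (k ∸ b)                           ∎)
          where
          open ≈-Reasoning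
          y = inverse i

        low-term : ∀ i j b → b < N → binomialTerm (x i) (-1ℤ * x j) e b
                   ≈ x i ^ e * inverse i ^ b * (-1ℤ ^ b * ℤ.+ (e C b) * x j ^ b)
        low-term i j b b<N = begin
          ℤ.+ (e C b) * (x i ^ (e ∸ b) * (-1ℤ * x j) ^ b)
            ≈⟨ *-congˡ (ℤ.+ (e C b))
                (*-cong (lower-power i b≤e) (≈-reflexive (^-distribʳ-* -1ℤ (x j) b))) ⟩
          ℤ.+ (e C b) * (x i ^ e * inverse i ^ b * (-1ℤ ^ b * x j ^ b))
            ≡⟨ regroup (ℤ.+ (e C b)) (x i ^ e) (inverse i ^ b) (-1ℤ ^ b) (x j ^ b) ⟩
          x i ^ e * inverse i ^ b * (-1ℤ ^ b * ℤ.+ (e C b) * x j ^ b) ∎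
          where
          open ≈-Reasoning
          b≤e : b ≤ e
          b≤e = ℕ.≤-trans (ℕ.<⇒≤ b<N) (ℕ.m≤n+m N m)
          regroup : ∀ c s t u v → c * (s * t * (u * v)) ≡ s * t * (u * c * v)
          regroup = solve-∀

        high-term : ∀ i j b → binomialTerm (x i) (-1ℤ * x j) e (N ℕ.+ b)
                    ≈ x i ^ e * inverse i ^ b * (-1ℤ ^ b * ℤ.+ (e C (N ℕ.+ b)) * x j ^ b)
        high-term i j b with N ℕ.+ b ℕ.≤? e
        -- Past exponent e the truncated difference is meaningless, but both sides carry the factor
        -- C(e, N + b) = 0.
        ... | no N+b≰e = ≈-reflexive (trans
          (cong (λ c → ℤ.+ c * (x i ^ (e ∸ (N ℕ.+ b)) * (-1ℤ * x j) ^ (N ℕ.+ b))) C≡0)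
          (trans (vanish (x i ^ (e ∸ (N ℕ.+ b)) * (-1ℤ * x j) ^ (N ℕ.+ b)) (x i ^ e * inverse i ^ b)
              (-1ℤ ^ b) (x j ^ b))
                 (cong (λ c → x i ^ e * inverse i ^ b * (-1ℤ ^ b * ℤ.+ c * x j ^ b)) (sym C≡0))))
          where
          C≡0 : e C (N ℕ.+ b) ≡ 0
          C≡0 = k>n⇒nCk≡0 (ℕ.≰⇒> N+b≰e)
          vanish : ∀ a s t u → 0ℤ * a ≡ s * (t * 0ℤ * u)
          vanish = solve-∀
        ... | yes N+b≤e = begin
          c * (x i ^ (e ∸ (N ℕ.+ b)) * (-1ℤ * x j) ^ (N ℕ.+ b))
            ≈⟨ *-congˡ c (*-cong x-power y-power) ⟩
          c * (x i ^ e * inverse i ^ b * (-1ℤ ^ b * x j ^ b))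
            ≡⟨ regroup c (x i ^ e) (inverse i ^ b) (-1ℤ ^ b) (x j ^ b) ⟩
          x i ^ e * inverse i ^ b * (-1ℤ ^ b * c * x j ^ b) ∎
          where
          open ≈-Reasoning
          c = ℤ.+ (e C (N ℕ.+ b))

          regroup : ∀ c s t u v → c * (s * t * (u * v)) ≡ s * t * (u * c * v)
          regroup = solve-∀

          split : e ∸ (N ℕ.+ b) ℕ.+ N ≡ e ∸ b
          split = trans (cong (ℕ._+ N)
              (trans (cong (e ∸_) (ℕ.+-comm N b)) (sym (ℕ.∸-+-assoc e b N))))
                        (ℕ.m∸n+n≡m (ℕ.m+n≤o⇒m≤o∸n N N+b≤e))

          x-power : x i ^ (e ∸ (N ℕ.+ b)) ≈ x i ^ e * inverse i ^ b
          x-power = begin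
            x i ^ (e ∸ (N ℕ.+ b))              ≡⟨ ℤ.*-identityʳ (x i ^ (e ∸ (N ℕ.+ b))) ⟨
            x i ^ (e ∸ (N ℕ.+ b)) * 1ℤ         ≈⟨ *-congˡ (x i ^ (e ∸ (N ℕ.+ b))) (x^N≈1 i) ⟨
            x i ^ (e ∸ (N ℕ.+ b)) * x i ^ N    ≡⟨ ℤ.^-distribˡ-+-* (x i) (e ∸ (N ℕ.+ b)) N ⟨
            x i ^ (e ∸ (N ℕ.+ b) ℕ.+ N)        ≡⟨ cong (x i ^_) split ⟩
            x i ^ (e ∸ b)                      ≈⟨ lower-power i (ℕ.≤-trans (ℕ.m≤n+m b N) N+b≤e) ⟩
            x i ^ e * inverse i ^ b            ∎

          y-power : (-1ℤ * x j) ^ (N ℕ.+ b) ≈ -1ℤ ^ b * x j ^ b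
          y-power = begin
            (-1ℤ * x j) ^ (N ℕ.+ b)                ≡⟨ ^-distribʳ-* -1ℤ (x j) (N ℕ.+ b) ⟩
            -1ℤ ^ (N ℕ.+ b) * x j ^ (N ℕ.+ b)      ≡⟨ cong₂ _*_ (ℤ.^-distribˡ-+-* -1ℤ N b)
                (ℤ.^-distribˡ-+-* (x j) N b) ⟩
            -1ℤ ^ N * -1ℤ ^ b * (x j ^ N * x j ^ b) ≈⟨ *-cong
                (*-congʳ (-1ℤ ^ b) (≈-reflexive -1^N≡1)) (*-congʳ (x j ^ b) (x^N≈1 j)) ⟩
            1ℤ * -1ℤ ^ b * (1ℤ * x j ^ b)          ≡⟨ cong₂ _*_ (ℤ.*-identityˡ (-1ℤ ^ b))
                (ℤ.*-identityˡ (x j ^ b)) ⟩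
            -1ℤ ^ b * x j ^ b                      ∎

        entry : ∀ i j → (x i + -1ℤ * x j) ^ e
                ≈ sum λ (b : Fin N) → x i ^ e * inverse i ^ toℕ b *
                    (coefficient (toℕ b) * x j ^ toℕ b)
        entry i j = begin
          (x i + -1ℤ * x j) ^ e
            -- The expansion is padded with zero terms to 2 N terms, more than e because m < N, so
            -- that it splits into two full blocks of exponents.
            ≡⟨ binomial-theorem (x i) (-1ℤ * x j) e (N ℕ.+ N) (ℕ.+-monoˡ-< N m<N) ⟩
          Σ< (N ℕ.+ N) term
            ≡⟨ Σ<-+ N N term ⟩
          Σ< N term + Σ< N (λ b → term (N ℕ.+ b))
            ≡⟨ ∑-distrib-+ (λ (b : Fin N) → term (toℕ b)) (λ b → term (N ℕ.+ toℕ b)) ⟨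
          sum (λ (b : Fin N) → term (toℕ b) + term (N ℕ.+ toℕ b))
            ≈⟨ sum-cong (λ b → ≈-trans
                (+-cong (low-term i j (toℕ b) (toℕ<n b)) (high-term i j (toℕ b)))
                 (≈-reflexive (trans
                   (collect (x i ^ e * inverse i ^ toℕ b) (-1ℤ ^ toℕ b) (ℤ.+ (e C toℕ b))
                       (ℤ.+ (e C (N ℕ.+ toℕ b))) (x j ^ toℕ b))
                   (cong (λ c → x i ^ e * inverse i ^ toℕ b * (-1ℤ ^ toℕ b * c * x j ^ toℕ b))
                     (sym (ℤ.pos-+ (e C toℕ b) (e C (N ℕ.+ toℕ b)))))))) ⟩
          sum (λ (b : Fin N) → x i ^ e * inverse i ^ toℕ b * (coefficient (toℕ b) * x j ^ toℕ b)) ∎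
          where
          open ≈-Reasoning
          term = binomialTerm (x i) (-1ℤ * x j) e

          collect : ∀ s t a b u → s * (t * a * u) + s * (t * b * u) ≡ s * (t * (a + b) * u)
          collect = solve-∀

        high-C : ∀ {b} → b ≤ m → e C (N ℕ.+ b) ≡ e C (m ∸ b)
        high-C {b} b≤m = trans (nCk≡nC[n∸k] N+b≤e)
            (cong (e C_) (trans (cong (_∸ (N ℕ.+ b)) (ℕ.+-comm m N)) (ℕ.[m+n]∸[m+o]≡n∸o N m b)))
          where
          N+b≤e : N ℕ.+ b ≤ e
          N+b≤e = subst (N ℕ.+ b ≤_) (ℕ.+-comm N m) (ℕ.+-monoʳ-≤ N b≤m)

        -1≉0 : -1ℤ ≉ 0ℤ
        -1≉0 -1≈0 = 1≉0 (*-congˡ -1ℤ -1≈0)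

        coefficient≈0⇒ : ∀ b → b < N → coefficient b ≈ 0ℤ →
                         b ≤ m × ℤ.+ ((e C b) ℕ.+ (e C (m ∸ b))) ≈ 0ℤ
        coefficient≈0⇒ b b<N cb≈0 with b ℕ.≤? m
        ... | yes b≤m = b≤m , subst (λ t → ℤ.+ ((e C b) ℕ.+ t) ≈ 0ℤ) (high-C b≤m)
                                (*≈0⇒ʳ (^≉0 { -1ℤ} b -1≉0) cb≈0)
        ... | no  b≰m = contradiction
          (subst (λ t → ℤ.+ t ≈ 0ℤ) (trans (cong ((e C b) ℕ.+_) C≡0) (ℕ.+-identityʳ (e C b)))
            (*≈0⇒ʳ (^≉0 { -1ℤ} b -1≉0) cb≈0))
          (C≉0 e b m+N<p (ℕ.≤-trans (ℕ.<⇒≤ b<N) (ℕ.m≤n+m N m)))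
          where
          C≡0 : e C (N ℕ.+ b) ≡ 0
          C≡0 = k>n⇒nCk≡0 (subst (_< N ℕ.+ b) (ℕ.+-comm N m) (ℕ.+-monoʳ-< N (ℕ.≰⇒> b≰m)))

        ⇒coefficient≈0 : ∀ {b} → b ≤ m → ℤ.+ ((e C b) ℕ.+ (e C (m ∸ b))) ≈ 0ℤ → coefficient b ≈ 0ℤ
        ⇒coefficient≈0 {b} b≤m C+C≈0 = begin
          -1ℤ ^ b * ℤ.+ ((e C b) ℕ.+ (e C (N ℕ.+ b)))  ≡⟨ cong (λ t → -1ℤ ^ b * ℤ.+ ((e C b) ℕ.+ t))
              (high-C b≤m) ⟩
          -1ℤ ^ b * ℤ.+ ((e C b) ℕ.+ (e C (m ∸ b)))    ≈⟨ *-congˡ (-1ℤ ^ b) C+C≈0 ⟩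
          -1ℤ ^ b * 0ℤ                                 ≡⟨ ℤ.*-zeroʳ (-1ℤ ^ b) ⟩
          0ℤ                                           ∎
          where open ≈-Reasoning

      det-criterion : (det λ i j → (x i + -1ℤ * x j) ^ e) ≈ 0ℤ ⇔
                      ∃ λ b → b ≤ m × ℤ.+ ((e C b) ℕ.+ (e C (m ∸ b))) ≈ 0ℤ
      det-criterion = mk⇔ forward backward
        where
        M X W : Matrix N
        M i j = (x i + -1ℤ * x j) ^ e
        X i b = x i ^ e * inverse i ^ toℕ b
        W b j = x j ^ toℕ b

        c : Vector ℤ N
        c b = coefficient (toℕ b)

        factored : det M ≈ det X * (prod c * det W)
        factored = det-factor M X W c entry

        X≉0 : det X ≉ 0ℤ
        X≉0 = scaled-vandermonde≉0 inverse inverse-distinct (λ i → x i ^ e) λ i → ^≉0 {x i} e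
            (x≉0 i)

        W≉0 : det W ≉ 0ℤ
        W≉0 = vandermonde≉0 x distinct

        prod-c≈0 : det M ≈ 0ℤ → prod c ≈ 0ℤ
        prod-c≈0 M≈0 = *≈0⇒ˡ {prod c} {det W} W≉0
            (*≈0⇒ʳ {det X} {prod c * det W} X≉0 (≈-trans (≈-sym factored) M≈0))

        forward : det M ≈ 0ℤ → ∃ λ b → b ≤ m × ℤ.+ ((e C b) ℕ.+ (e C (m ∸ b))) ≈ 0ℤ
        forward M≈0 =
          let i , ci≈0 = prod≈0⇒ c (prod-c≈0 M≈0)
          in toℕ i , coefficient≈0⇒ (toℕ i) (toℕ<n i) ci≈0

        backward : (∃ λ b → b ≤ m × ℤ.+ ((e C b) ℕ.+ (e C (m ∸ b))) ≈ 0ℤ) → det M ≈ 0ℤ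
        backward (b , b≤m , C+C≈0) = begin
          det M                       ≈⟨ factored ⟩
          det X * (prod c * det W)    ≈⟨ *-congˡ (det X)
              (*-congʳ (det W) (prod≈0 {f = c} (fromℕ< b<N) cb≈0)) ⟩
          det X * (0ℤ * det W)        ≡⟨ trans (cong (det X *_) (ℤ.*-zeroˡ (det W)))
              (ℤ.*-zeroʳ (det X)) ⟩
          0ℤ                          ∎
          where
          open ≈-Reasoning
          b<N : b < N
          b<N = ℕ.≤-<-trans b≤m m<N

          cb≈0 : coefficient (toℕ (fromℕ< b<N)) ≈ 0ℤ
          cb≈0 = subst (λ t → coefficient t ≈ 0ℤ) (sym (toℕ-fromℕ< b<N)) (⇒coefficient≈0 b≤m C+C≈0)

open import Data.Fin.Base using (Fin)
open import Data.Integer.Base as ℤ using (ℤ; +_; 0ℤ; 1ℤ; -1ℤ)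
import Data.Integer.Properties as ℤ
import Data.Integer.Divisibility as Unsigned
open import Data.List.Base using (upTo; filter)
open import Data.List.Membership.Propositional.Properties using (∈-filter⁺; ∈-filter⁻; ∈-upTo⁺)
open import Data.Nat.Base
open import Data.Nat.Combinatorics using (_C_)
open import Data.Nat.DivMod using (_/_; m/n*n≡m)
open import Data.Nat.Divisibility
open import Data.Nat.Primality using (Prime; prime?; ¬prime[0]; ¬prime[1])
open import Data.Nat.Properties
open import Data.Nat.Tactic.RingSolver using (solve-∀)
open import Data.Product.Base using (_×_; ∃; _,_; proj₂)
open import Data.Sum.Base using (_⊎_; inj₁; inj₂)
open import Function.Bundles using (_⇔_; mk⇔; Equivalence)
open import Level using (0ℓ)
open import Relation.Binary.PropositionalEquality
open import Relation.Nullary.Decidable using (yes; no; _×-dec_; ¬?)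
open import Relation.Nullary.Negation.Core using (¬_; contradiction)
open import Relation.Unary using (Pred; Empty; _∈_; Decidable)
open Congruences
open Equivalence using (to; from)

odd⇒≡1+2h : ∀ {m} → Odd m → m ≡ suc ((m ∸ 1) / 2 * 2)
odd⇒≡1+2h {zero}  odd = contradiction (2 ∣0) odd
odd⇒≡1+2h {suc m} odd = cong suc (sym (m/n*n≡m (even m odd)))
  where
  even : ∀ m → Odd (suc m) → 2 ∣ m
  even zero          odd = 2 ∣0
  even (suc zero)    odd = contradiction ∣-refl odd
  even (suc (suc m)) odd = ∣m∣n⇒∣m+n ∣-refl (even m λ 2∣ → odd (∣m∣n⇒∣m+n ∣-refl 2∣))

-1^even : ∀ {n} → 2 ∣ n → -1ℤ ℤ.^ n ≡ 1ℤ
-1^even (divides q refl) = trans (cong (-1ℤ ℤ.^_) (*-comm q 2))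
  (trans (sym (ℤ.^-*-assoc -1ℤ 2 q)) (ℤ.^-zeroˡ q))

-- For a successor the integer difference reduces to the natural one and both sides become the same
-- type; only p = 0 has to be excluded.
≡1⇔∣ : ∀ {p n} → Prime p → (+ p ≡ 1ℤ [mod n ]) ⇔ n ∣ p ∸ 1
≡1⇔∣ {zero}  p-prime = contradiction p-prime ¬prime[0]
≡1⇔∣ {suc p} p-prime = mk⇔ (λ n∣p → n∣p) (λ n∣p → n∣p)

bounded⇒finite : ∀ {P : Pred ℕ 0ℓ} {B} → Decidable P → (∀ {n} → P n → n ≤ B) → Finite P
bounded⇒finite {B = B} P? bounded = filter P? (upTo (suc B)) , λ n → mk⇔
  (λ Pn → ∈-filter⁺ P? (∈-upTo⁺ (s≤s (bounded Pn))) Pn)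
  (λ n∈xs → proj₂ (∈-filter⁻ P? {xs = upTo (suc B)} n∈xs))

-- Integer divisibility unfolds to divisibility of absolute values in ℕ, and the last component
-- decides that.
E? : ∀ k .{{_ : NonZero k}} α m → Decidable (E k α m)
E? k α m p = prime? p ×-dec ¬? (2 ∣? p) ×-dec 2 * k ∣? p ∸ 1 ×-dec p ∣? _

-- k-factorials and binomial coefficients modulo p.

module _ (k : ℕ) .{{_ : NonZero k}} (2≤k : 2 ≤ k) where

  -- Q i = kⁱ i! and R i = ∏ (k j − 1) over 1 ≤ j ≤ i; Q 0 = R 0 = 1 relies on the
  -- convention 0!⟨k⟩ = 1 and on the truncation 0 ∸ 1 = 0.
  Q R : ℕ → ℕ
  Q i = (k * i) !⟨ k ⟩
  R i = (k * i ∸ 1) !⟨ k ⟩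

  Q-zero : Q 0 ≡ 1
  Q-zero = cong _!⟨ k ⟩ (*-zeroʳ k)

  R-zero : R 0 ≡ 1
  R-zero = cong (λ a → (a ∸ 1) !⟨ k ⟩) (*-zeroʳ k)

  1≤k : 1 ≤ k
  1≤k = ≤-trans (s≤s z≤n) 2≤k

  k≤k*1+i : ∀ i → k ≤ k * suc i
  k≤k*1+i i = m≤m*n k (suc i)

  Q-suc : ∀ i → Q (suc i) ≡ k * suc i * Q i
  Q-suc zero = trans (!-base (k * 1) k (≤-trans 1≤k (k≤k*1+i 0)) (≤-reflexive (*-identityʳ k)))
    (sym (trans (cong (k * 1 *_) Q-zero) (*-identityʳ (k * 1))))
  Q-suc (suc i) = trans (!-step (k * suc (suc i)) k k<)
    (cong (λ a → k * suc (suc i) * a !⟨ k ⟩)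
      (trans (cong (_∸ k) (*-suc k (suc i))) (m+n∸m≡n k (k * suc i))))
    where
    k< : k < k * suc (suc i)
    k< = subst (k <_) (sym (*-suc k (suc i))) (m<m+n k (≤-trans 1≤k (k≤k*1+i i)))

  R-suc : ∀ i → R (suc i) ≡ (k * suc i ∸ 1) * R i
  R-suc zero = trans
    -- The base equation is about positive arguments, and k - 1 ≥ 1 comes from k ≥ 2.
    (!-base (k * 1 ∸ 1) k (∸-monoˡ-≤ 1 (≤-trans 2≤k (k≤k*1+i 0)))
      (≤-trans (m∸n≤m (k * 1) 1) (≤-reflexive (*-identityʳ k))))
    (sym (trans (cong ((k * 1 ∸ 1) *_) R-zero) (*-identityʳ (k * 1 ∸ 1))))
  R-suc (suc i) = trans (!-step (k * suc (suc i) ∸ 1) k k<)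
    (cong (λ a → (k * suc (suc i) ∸ 1) * a !⟨ k ⟩) (begin
      k * suc (suc i) ∸ 1 ∸ k      ≡⟨ ∸-+-assoc (k * suc (suc i)) 1 k ⟩
      k * suc (suc i) ∸ (1 + k)    ≡⟨ cong₂ _∸_ (*-suc k (suc i)) (+-comm 1 k) ⟩
      k + k * suc i ∸ (k + 1)      ≡⟨ [m+n]∸[m+o]≡n∸o k (k * suc i) 1 ⟩
      k * suc i ∸ 1                ∎))
    where
    open ≡-Reasoning
    k< : k < k * suc (suc i) ∸ 1
    k< = m+n≤o⇒m≤o∸n (suc k)
        (subst₂ _≤_ (trans (+-comm k 2) (+-comm 1 (suc k))) (sym (*-suc k (suc i)))
           (+-monoʳ-≤ k (≤-trans 2≤k (k≤k*1+i i))))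

  Q-∣ : ∀ i j → Q i ∣ Q (j + i)
  Q-∣ i zero    = ∣-refl
  Q-∣ i (suc j) = subst (Q i ∣_) (sym (Q-suc (j + i))) (∣n⇒∣m*n (k * suc (j + i)) (Q-∣ i j))

  R-∣ : ∀ i j → R i ∣ R (j + i)
  R-∣ i zero    = ∣-refl
  R-∣ i (suc j) = subst (R i ∣_) (sym (R-suc (j + i))) (∣n⇒∣m*n (k * suc (j + i) ∸ 1) (R-∣ i j))

  Q≤Q : ∀ {i j} → i ≤ j → Q i ≤ Q j
  Q≤Q {i} {j} i≤j = ∣⇒≤ {{ !-nonZero (k * j) k}}
      (subst (λ t → Q i ∣ Q t) (m∸n+n≡m i≤j) (Q-∣ i (j ∸ i)))

  R≤R : ∀ {i j} → i ≤ j → R i ≤ R j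
  R≤R {i} {j} i≤j = ∣⇒≤ {{ !-nonZero (k * j ∸ 1) k}}
      (subst (λ t → R i ∣ R t) (m∸n+n≡m i≤j) (R-∣ i (j ∸ i)))

  module _ (m : ℕ) where

    -- The two quotients of the theorem. At l = 0 the conventions behind Q 0 = R 0 = 1 turn them
    -- into Q m and R m, which merges the two divisibility conditions into one family.
    q r : ℕ → ℕ
    q l = !-quotient k (k * m ∸ k * l) (k * l)
    r l = !-quotient k (k * m ∸ k * l ∸ 1) (k * l ∸ 1)

    q*Q : ∀ {l} → l ≤ m ∸ l → q l * Q l ≡ Q (m ∸ l)
    q*Q {l} l≤m∸l = trans (m/n*n≡m {{ !-nonZero (k * l) k}} Q∣) (cong _!⟨ k ⟩ (sym k*))
      where
      k* : k * (m ∸ l) ≡ k * m ∸ k * l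
      k* = *-distribˡ-∸ k m l
      Q∣ : Q l ∣ (k * m ∸ k * l) !⟨ k ⟩
      Q∣ = subst (λ a → Q l ∣ a !⟨ k ⟩) k*
          (subst (λ t → Q l ∣ Q t) (m∸n+n≡m l≤m∸l) (Q-∣ l (m ∸ l ∸ l)))

    r*R : ∀ {l} → l ≤ m ∸ l → r l * R l ≡ R (m ∸ l)
    r*R {l} l≤m∸l = trans (m/n*n≡m {{ !-nonZero (k * l ∸ 1) k}} R∣)
        (cong (λ a → (a ∸ 1) !⟨ k ⟩) (sym k*))
      where
      k* : k * (m ∸ l) ≡ k * m ∸ k * l
      k* = *-distribˡ-∸ k m l
      R∣ : R l ∣ (k * m ∸ k * l ∸ 1) !⟨ k ⟩
      R∣ = subst (λ a → R l ∣ (a ∸ 1) !⟨ k ⟩) k*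
          (subst (λ t → R l ∣ R t) (m∸n+n≡m l≤m∸l) (R-∣ l (m ∸ l ∸ l)))

    q-zero : q 0 ≡ Q m
    q-zero = trans (sym (*-identityʳ (q 0))) (trans (cong (q 0 *_) (sym Q-zero)) (q*Q {0} z≤n))

    r-zero : r 0 ≡ R m
    r-zero = trans (sym (*-identityʳ (r 0))) (trans (cong (r 0 *_) (sym R-zero)) (r*R {0} z≤n))

    q≤Q : ∀ {l} → l ≤ m ∸ l → q l ≤ Q m
    q≤Q {l} l≤m∸l = ≤-trans (m≤m*n (q l) (Q l) {{ !-nonZero (k * l) k}})
      (≤-trans (≤-reflexive (q*Q l≤m∸l)) (Q≤Q (m∸n≤m m l)))

    r≤R : ∀ {l} → l ≤ m ∸ l → r l ≤ R m
    r≤R {l} l≤m∸l = ≤-trans (m≤m*n (r l) (R l) {{ !-nonZero (k * l ∸ 1) k}})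
      (≤-trans (≤-reflexive (r*R l≤m∸l)) (R≤R (m∸n≤m m l)))

    -- Positivity is what turns p ∣ q l + r l into an upper bound for p; the bound becomes
    -- independent of `l` through `q≤Q` and `r≤R`.
    q+r-nonZero : ∀ {l} → l ≤ m ∸ l → NonZero (q l + r l)
    q+r-nonZero {l} l≤m∸l = >-nonZero (≤-trans (n≢0⇒n>0 q≢0) (m≤m+n (q l) (r l)))
      where
      q≢0 : q l ≢ 0
      q≢0 ql≡0 = ≢-nonZero⁻¹ (Q (m ∸ l)) {{ !-nonZero (k * (m ∸ l)) k}}
        (trans (sym (q*Q l≤m∸l)) (cong (_* Q l) ql≡0))

    module _ {p N : ℕ} (p-prime : Prime p) (p≡1+kN : p ≡ suc (k * N)) (m<N : m < N) where
      open ModuloPrime p-prime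

      private
        n = m + N

      +p*≈ : ∀ a t → + (a + t * p) ≈ + a
      +p*≈ a t = congruent (+ t) (trans (ℤ.pos-+ a (t * p)) (cong (ℤ._+_ (+ a)) (ℤ.pos-* t p)))

      kl<p : ∀ {l} → l ≤ m → k * l < p
      kl<p l≤m = ≤-<-trans (*-monoʳ-≤ k (≤-trans l≤m (<⇒≤ m<N))) (≤-reflexive (sym p≡1+kN))

      -- Because n ≤ 2 N ≤ k N = p - 1, by k ≥ 2.
      n<p : n < p
      n<p = ≤-<-trans (≤-trans (+-monoˡ-≤ N (<⇒≤ m<N))
          (≤-trans (≤-reflexive (cong (λ t → N + t) (sym (+-identityʳ N)))) (*-monoˡ-≤ N 2≤k)))
          (≤-reflexive (sym p≡1+kN))

      -- Each factor k j with 1 ≤ j ≤ m lies strictly between 0 and p. The same holds for the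
      -- factors k j - 1 of R.
      Q≉0 : ∀ l → l ≤ m → + Q l ≉ 0ℤ
      Q≉0 zero    l≤m = subst (λ t → + t ≉ 0ℤ) (sym Q-zero) 1≉0
      Q≉0 (suc l) l<m = subst (_≉ 0ℤ)
          (trans (sym (ℤ.pos-* (k * suc l) (Q l))) (cong +_ (sym (Q-suc l))))
        (*≉0 (positive-below (≤-trans 1≤k (k≤k*1+i l)) (kl<p l<m)) (Q≉0 l (<⇒≤ l<m)))

      R≉0 : ∀ l → l ≤ m → + R l ≉ 0ℤ
      R≉0 zero    l≤m = subst (λ t → + t ≉ 0ℤ) (sym R-zero) 1≉0
      R≉0 (suc l) l<m = subst (_≉ 0ℤ)
          (trans (sym (ℤ.pos-* (k * suc l ∸ 1) (R l))) (cong +_ (sym (R-suc l))))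
        (*≉0 (positive-below (∸-monoˡ-≤ 1 (≤-trans 2≤k (k≤k*1+i l)))
            (≤-<-trans (m∸n≤m (k * suc l) 1) (kl<p l<m)))
             (R≉0 l (<⇒≤ l<m)))

      -- (i + 1) C(n, i + 1) = (n − i) C(n, i) times k, where k (n − i) = k (m − i) − 1 + p.
      kC-suc : ∀ i j → i + suc j ≡ m →
               k * suc i * (n C suc i) ≡ (k * suc j ∸ 1) * (n C i) + (n C i) * p
      kC-suc i j i+1+j≡m = begin
        k * suc i * b                              ≡⟨ *-assoc k (suc i) b ⟩
        k * (suc i * b)                            ≡⟨ cong (k *_) ratio ⟩
        k * ((suc j + N) * a)                      ≡⟨ expand k j N a ⟩
        k * suc j * a + a * (k * N)                ≡⟨ cong (λ t → t * a + a * (k * N))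
            (sym (m∸n+n≡m 1≤kj)) ⟩
        (k * suc j ∸ 1 + 1) * a + a * (k * N)      ≡⟨ regroup (k * suc j ∸ 1) a (k * N) ⟩
        (k * suc j ∸ 1) * a + a * suc (k * N)      ≡⟨ cong
            (λ t → (k * suc j ∸ 1) * a + a * t) p≡1+kN ⟨
        (k * suc j ∸ 1) * a + a * p                ∎
        where
        open ≡-Reasoning
        a = n C i
        b = n C suc i

        1≤kj : 1 ≤ k * suc j
        1≤kj = ≤-trans 1≤k (k≤k*1+i j)

        expand : ∀ k j N a → k * ((suc j + N) * a) ≡ k * suc j * a + a * (k * N)
        expand = solve-∀

        regroup : ∀ c a t → (c + 1) * a + a * t ≡ c * a + a * suc t
        regroup = solve-∀

        split : ∀ i j N a → (i + suc j + N) * a ≡ (suc j + N) * a + i * a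
        split = solve-∀

        ratio : suc i * b ≡ (suc j + N) * a
        ratio = +-cancelʳ-≡ (i * a) _ _ (trans (C-ratio n i)
          (trans (cong (λ t → (t + N) * a) (sym i+1+j≡m)) (split i j N a)))

      -- Informally, Q i C(n, i) is the product of k (n - t) over t < i. As k N ≈ -1, each factor is
      -- congruent to k (m - t) - 1, so the product is R m / R (m - i). The proof passes from `i` to
      -- `suc i` by moving one such factor out of R j.
      QRC≈R : ∀ i j → i + j ≡ m → + (Q i * R j * (n C i)) ≈ + R m
      QRC≈R zero    j refl = ≈-reflexive
          (cong +_ (trans (*-identityʳ (Q 0 * R j))
          (trans (cong (_* R j) Q-zero) (*-identityˡ (R j)))))
      QRC≈R (suc i) j 1+i+j≡m = begin
        + (Q (suc i) * R j * (n C suc i))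
          ≡⟨ cong +_ step ⟩
        + (Q i * R (suc j) * (n C i) + Q i * R j * (n C i) * p)
          ≈⟨ +p*≈ (Q i * R (suc j) * (n C i)) (Q i * R j * (n C i)) ⟩
        + (Q i * R (suc j) * (n C i))
          ≈⟨ QRC≈R i (suc j) i+1+j≡m ⟩
        + R m ∎
        where
        open ≈-Reasoning
        i+1+j≡m : i + suc j ≡ m
        i+1+j≡m = trans (+-suc i j) 1+i+j≡m

        collect : ∀ c Q R b → c * Q * R * b ≡ Q * R * (c * b)
        collect = solve-∀

        distribute : ∀ Q R c a p → Q * R * (c * a + a * p) ≡ Q * (c * R) * a + Q * R * a * p
        distribute = solve-∀

        step : Q (suc i) * R j * (n C suc i) ≡ Q i * R (suc j) * (n C i) + Q i * R j * (n C i) * p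
        step = trans (cong (λ t → t * R j * (n C suc i)) (Q-suc i))
          (trans (collect (k * suc i) (Q i) (R j) (n C suc i))
          (trans (cong (Q i * R j *_) (kC-suc i j i+1+j≡m))
          (trans (distribute (Q i) (R j) (k * suc j ∸ 1) (n C i) p)
                 (cong (λ t → Q i * t * (n C i) + Q i * R j * (n C i) * p) (sym (R-suc j))))))

      -- The invariant takes the same value R m at i = l and at i = m - l; what remains is to cancel
      -- Q l R l, which is prime to p.
      rC≈qC : ∀ {l} → l ≤ m ∸ l → + (r l * (n C l)) ≈ + (q l * (n C (m ∸ l)))
      rC≈qC {l} l≤m∸l = *-cancelˡ (+ (Q l * R l)) QR≉0 (begin
        + (Q l * R l) ℤ.* + (r l * (n C l))              ≡⟨ ℤ.pos-* (Q l * R l) (r l * (n C l)) ⟨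
        + (Q l * R l * (r l * (n C l)))                  ≡⟨ cong +_ left ⟩
        + (Q l * R (m ∸ l) * (n C l))                    ≈⟨ QRC≈R l (m ∸ l) (m+[n∸m]≡n l≤m) ⟩
        + R m                                            ≈⟨ QRC≈R (m ∸ l) l (m∸n+n≡m l≤m) ⟨
        + (Q (m ∸ l) * R l * (n C (m ∸ l)))              ≡⟨ cong +_ right ⟨
        + (Q l * R l * (q l * (n C (m ∸ l))))            ≡⟨ ℤ.pos-* (Q l * R l)
            (q l * (n C (m ∸ l))) ⟩
        + (Q l * R l) ℤ.* + (q l * (n C (m ∸ l)))        ∎)
        where
        open ≈-Reasoning
        l≤m : l ≤ m
        l≤m = ≤-trans l≤m∸l (m∸n≤m m l)

        QR≉0 : + (Q l * R l) ≉ 0ℤ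
        QR≉0 = subst (_≉ 0ℤ) (sym (ℤ.pos-* (Q l) (R l))) (*≉0 (Q≉0 l l≤m) (R≉0 l l≤m))

        left : Q l * R l * (r l * (n C l)) ≡ Q l * R (m ∸ l) * (n C l)
        left = trans (regroup (Q l) (R l) (r l) (n C l))
            (cong (λ t → Q l * t * (n C l)) (r*R l≤m∸l))
          where
          regroup : ∀ a b c d → a * b * (c * d) ≡ a * (c * b) * d
          regroup = solve-∀

        right : Q l * R l * (q l * (n C (m ∸ l))) ≡ Q (m ∸ l) * R l * (n C (m ∸ l))
        right = trans (regroup (Q l) (R l) (q l) (n C (m ∸ l)))
            (cong (λ t → t * R l * (n C (m ∸ l))) (q*Q l≤m∸l))
          where
          regroup : ∀ a b c d → a * b * (c * d) ≡ (c * a) * b * d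
          regroup = solve-∀

      -- Multiplying the sum by q l gives C(n, l) (q l + r l) modulo p, and both multipliers q l and
      -- C(n, l) are prime to p.
      C+C≈0⇔∣q+r : ∀ {l} → l ≤ m ∸ l → + ((n C l) + (n C (m ∸ l))) ≈ 0ℤ ⇔ p ∣ q l + r l
      C+C≈0⇔∣q+r {l} l≤m∸l = mk⇔
        (λ C+C≈0 → to ≈0⇔∣ (*≈0⇒ʳ {+ (n C l)} {+ (q l + r l)} C≉0l (≈-trans (≈-sym balance)
           (≈-trans (*-congˡ (+ q l) C+C≈0) (≈-reflexive (ℤ.*-zeroʳ (+ q l)))))))
        (λ p∣q+r → *≈0⇒ʳ {+ q l} {+ ((n C l) + (n C (m ∸ l)))} q≉0 (≈-trans balance
           (≈-trans (*-congˡ (+ (n C l)) (from ≈0⇔∣ p∣q+r))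
               (≈-reflexive (ℤ.*-zeroʳ (+ (n C l)))))))
        where
        l≤m : l ≤ m
        l≤m = ≤-trans l≤m∸l (m∸n≤m m l)

        C≉0l : + (n C l) ≉ 0ℤ
        C≉0l = C≉0 n l n<p (≤-trans l≤m (m≤m+n m N))

        q≉0 : + q l ≉ 0ℤ
        q≉0 ql≈0 = Q≉0 (m ∸ l) (m∸n≤m m l) (≈-trans
          (≈-reflexive (trans (cong +_ (sym (q*Q l≤m∸l))) (ℤ.pos-* (q l) (Q l))))
          (≈-trans (*-congʳ (+ Q l) ql≈0) (≈-reflexive (ℤ.*-zeroˡ (+ Q l)))))

        balance : + q l ℤ.* + ((n C l) + (n C (m ∸ l))) ≈ + (n C l) ℤ.* + (q l + r l)
        balance = begin
          + q l ℤ.* + (a + b)            ≡⟨ ℤ.pos-* (q l) (a + b) ⟨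
          + (q l * (a + b))              ≡⟨ cong +_ (*-distribˡ-+ (q l) a b) ⟩
          + (q l * a + q l * b)          ≡⟨ ℤ.pos-+ (q l * a) (q l * b) ⟩
          + (q l * a) ℤ.+ + (q l * b)    ≈⟨ +-cong (≈-refl {+ (q l * a)}) (rC≈qC l≤m∸l) ⟨
          + (q l * a) ℤ.+ + (r l * a)    ≡⟨ ℤ.pos-+ (q l * a) (r l * a) ⟨
          + (q l * a + r l * a)          ≡⟨ cong +_ (collect a (q l) (r l)) ⟩
          + (a * (q l + r l))            ≡⟨ ℤ.pos-* a (q l + r l) ⟩
          + a ℤ.* + (q l + r l)          ∎
          where
          open ≈-Reasoning
          a = n C l
          b = n C (m ∸ l)
          collect : ∀ a q r → q * a + r * a ≡ a * (q + r)
          collect = solve-∀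

  -- The sets E_k(m).

  module _ (α : (p : ℕ) → Fin ((p ∸ 1) / k) → ℤ)
           (α-represents : ∀ p → Prime p → Odd p → k ∣ p ∸ 1 → RepresentsPowerResidues k p (α p))
           where

    module _ {m : ℕ} (m-odd : Odd m) where

      private
        h = (m ∸ 1) / 2

        m≡1+h+h : m ≡ suc h + h
        m≡1+h+h = trans (odd⇒≡1+2h m-odd)
            (cong suc (trans (*-comm h 2) (cong (_+_ h) (+-identityʳ h))))

      ≤h⇒≤m∸ : ∀ {l} → l ≤ h → l ≤ m ∸ l
      ≤h⇒≤m∸ {l} l≤h = m+n≤o⇒m≤o∸n l
          (≤-trans (+-mono-≤ (m≤n⇒m≤1+n l≤h) l≤h) (≤-reflexive (sym m≡1+h+h)))

      -- Since m = 2 h + 1, each pair b, m - b has a member in the range 0 ≤ l ≤ h.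
      ≰h⇒m∸≤h : ∀ {l} → ¬ (l ≤ h) → m ∸ l ≤ h
      ≰h⇒m∸≤h {l} l≰h = m≤n+o⇒m∸n≤o m l (≤-trans (≤-reflexive m≡1+h+h) (+-monoˡ-≤ h (≰⇒> l≰h)))

      module _ {p : ℕ} (p-prime : Prime p) (km+1<p : k * m + 1 < p)
               (p-odd : Odd p) (2k∣p-1 : 2 * k ∣ p ∸ 1) where
        open ModuloPrime p-prime

        private
          N = (p ∸ 1) / k

          k∣p-1 : k ∣ p ∸ 1
          k∣p-1 = ∣-trans (n∣m*n 2) 2k∣p-1

          kN≡p-1 : k * N ≡ p ∸ 1
          kN≡p-1 = trans (*-comm k N) (m/n*n≡m k∣p-1)

          p≡1+kN : p ≡ suc (k * N)
          p≡1+kN = trans (sym (m+[n∸m]≡n (≤-trans (s≤s z≤n) km+1<p))) (cong suc (sym kN≡p-1))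

          -- With p = 1 + k N the assumption p > k m + 1 reads k m < k N.
          m<N : m < N
          m<N = *-cancelˡ-< k m N (s<s⁻¹ (subst₂ _<_ (+-comm (k * m) 1) p≡1+kN km+1<p))

          2∣N : 2 ∣ N
          2∣N = *-cancelˡ-∣ k (subst₂ _∣_ (*-comm 2 k) (sym kN≡p-1) 2k∣p-1)

          open RepresentsPowerResidues (α-represents p p-prime p-odd k∣p-1)

          -- A residue is congruent to some x^k, and x^(k N) = x^(p - 1) ≈ 1 by Fermat; p cannot
          -- divide x, since it would then divide the residue.
          α^N≈1 : ∀ i → α p i ℤ.^ N ≈ 1ℤ
          α^N≈1 i = let αi≢0 , x , x^k≡αi = residue i
                        x^k≈αi = from (≈⇔∣ {x ℤ.^ k} {α p i}) x^k≡αi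
                    in begin
            α p i ℤ.^ N          ≈⟨ ^-cong N x^k≈αi ⟨
            (x ℤ.^ k) ℤ.^ N      ≡⟨ ℤ.^-*-assoc x k N ⟩
            x ℤ.^ (k * N)        ≡⟨ cong (x ℤ.^_) kN≡p-1 ⟩
            x ℤ.^ (p ∸ 1)        ≈⟨ fermat-little x (λ x≈0 → αi≢0 (to ≈⇔∣
                                      (≈-trans (≈-sym x^k≈αi)
                                          (≈-trans (^-cong k x≈0) (≈-reflexive (0^ k)))))) ⟩
            1ℤ                   ∎
            where
            open ≈-Reasoning
            0^ : ∀ k .{{_ : NonZero k}} → 0ℤ ℤ.^ k ≡ 0ℤ
            0^ (suc k) = refl

        ∣S⇔∣q+r : + p Unsigned.∣ S (m + N) -1ℤ (α p) ⇔ ∃ λ l → l ≤ h × p ∣ q m l + r m l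
        ∣S⇔∣q+r = mk⇔
          (λ p∣S → let b , b≤m , C+C≈0 = to criterion (from ≈0⇔∣ p∣S) in fold b b≤m C+C≈0)
          (λ (l , l≤h , p∣q+r) → to ≈0⇔∣ (from criterion
             (l , ≤-trans (≤h⇒≤m∸ l≤h) (m∸n≤m m l) ,
              from (C+C≈0⇔∣q+r m p-prime p≡1+kN m<N (≤h⇒≤m∸ l≤h)) p∣q+r)))
          where
          criterion = det-criterion p-prime {N} {m} (-1^even 2∣N) m<N (n<p m p-prime p≡1+kN m<N)
                        (α p) α^N≈1 (λ i j αi≈αj → distinct i j (to ≈⇔∣ αi≈αj))

          fold : ∀ b → b ≤ m → + ((m + N) C b + (m + N) C (m ∸ b)) ≈ 0ℤ →
                 ∃ λ l → l ≤ h × p ∣ q m l + r m l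
          fold b b≤m C+C≈0 with b ≤? h
          ... | yes b≤h = b , b≤h , to (C+C≈0⇔∣q+r m p-prime p≡1+kN m<N (≤h⇒≤m∸ b≤h)) C+C≈0
          ... | no  b≰h = m ∸ b , ≰h⇒m∸≤h b≰h ,
            to (C+C≈0⇔∣q+r m p-prime p≡1+kN m<N (≤h⇒≤m∸ (≰h⇒m∸≤h b≰h)))
              (subst (λ t → + t ≈ 0ℤ) (trans (+-comm ((m + N) C b) ((m + N) C (m ∸ b)))
                (cong (λ t → (m + N) C (m ∸ b) + (m + N) C t) (sym (m∸[m∸n]≡n b≤m)))) C+C≈0)

      E⇔∣q+r : ∀ {p} → Prime p → k * m + 1 < p →
               p ∈ E k α m ⇔ (2 * k ∣ p ∸ 1 × ∃ λ l → l ≤ h × p ∣ q m l + r m l)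
      E⇔∣q+r {p} p-prime km+1<p = mk⇔
        (λ (_ , p-odd , 2k∣p-1 , p∣S) → 2k∣p-1 , to (∣S⇔∣q+r p-prime km+1<p p-odd 2k∣p-1) p∣S)
        (λ (2k∣p-1 , ∣q+r) → p-prime , p-odd 2k∣p-1 , 2k∣p-1 ,
           from (∣S⇔∣q+r p-prime km+1<p (p-odd 2k∣p-1) 2k∣p-1) ∣q+r)
        where
        -- Here p - 1 is even, so 2 ∣ p would give 2 ∣ 1.
        p-odd : 2 * k ∣ p ∸ 1 → Odd p
        p-odd 2k∣p-1 2∣p with ∣1⇒≡1 (∣m+n∣m⇒∣n (subst (2 ∣_) (sym (m∸n+n≡m 1≤p)) 2∣p)
                                                (∣-trans (m∣m*n k) 2k∣p-1))
          where
          1≤p : 1 ≤ p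
          1≤p = ≤-trans (s≤s z≤n) km+1<p
        ... | ()

      -- Primes up to k m + 1 lie outside the range of the criterion but are bounded as they stand;
      -- a larger member divides some positive q l + r l, which is at most Q m + R m whatever `l`
      -- is.
      E-bounded : ∀ {p} → p ∈ E k α m → p ≤ k * m + 1 + (Q m + R m)
      E-bounded {p} p∈E@(p-prime , _) with k * m + 1 <? p
      ... | no  km+1≮p = ≤-trans (≮⇒≥ km+1≮p) (m≤m+n (k * m + 1) (Q m + R m))
      ... | yes km+1<p =
        let _ , l , l≤h , p∣q+r = to (E⇔∣q+r p-prime km+1<p) p∈E
            l≤m∸l = ≤h⇒≤m∸ l≤h
        in ≤-trans (∣⇒≤ {{q+r-nonZero m l≤m∸l}} p∣q+r)
             (≤-trans (+-mono-≤ (q≤Q m l≤m∸l) (r≤R m l≤m∸l)) (m≤n+m (Q m + R m) (k * m + 1)))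

      E-finite : Finite (E k α m)
      E-finite = bounded⇒finite (E? k α m) E-bounded

    -- For m = 1 only l = 0 is available, and a member would divide Q 1 + R 1 = k + (k - 1), hence
    -- be at most 2 k. But 2 k ∣ p - 1 forces p > 2 k.
    E-1-empty : Empty (E k α 1)
    E-1-empty p p∈E@(p-prime , _ , 2k∣p-1 , _) = ≤⇒≯ p≤2k 2k<p
      where
      1-odd : Odd 1
      1-odd 2∣1 with ∣1⇒≡1 2∣1
      ... | ()

      1<p : 1 < p
      1<p = 1<prime p-prime
        where
        1<prime : ∀ {p} → Prime p → 1 < p
        1<prime {0}           p-prime = contradiction p-prime ¬prime[0]
        1<prime {1}           p-prime = contradiction p-prime ¬prime[1]
        1<prime {suc (suc p)} p-prime = s≤s (s≤s z≤n)

      2k<p : 2 * k < p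
      2k<p = ≤-trans (s≤s (∣⇒≤ {{>-nonZero (∸-monoˡ-≤ 1 1<p)}} 2k∣p-1))
                     (≤-reflexive (m+[n∸m]≡n (<⇒≤ 1<p)))

      -- As k + 1 ≤ 2 k < p, every candidate lies in the range of the criterion.
      k*1+1<p : k * 1 + 1 < p
      k*1+1<p = ≤-<-trans (≤-trans (+-mono-≤ (≤-reflexive (*-identityʳ k)) 1≤k)
          (≤-reflexive (cong (_+_ k) (sym (+-identityʳ k))))) 2k<p

      only-l≡0 : (∃ λ l → l ≤ 0 × p ∣ q 1 l + r 1 l) → p ∣ Q 1 + R 1
      only-l≡0 (.0 , z≤n , p∣q+r) = subst (p ∣_) (cong₂ _+_ (q-zero 1) (r-zero 1)) p∣q+r

      p∣Q+R : p ∣ Q 1 + R 1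
      p∣Q+R = only-l≡0 (proj₂ (to (E⇔∣q+r 1-odd p-prime k*1+1<p) p∈E))

      Q1 : Q 1 ≡ k
      Q1 = trans (Q-suc 0) (trans (cong₂ _*_ (*-identityʳ k) Q-zero) (*-identityʳ k))

      R1 : R 1 ≡ k ∸ 1
      R1 = trans (R-suc 0) (trans (cong₂ (λ a b → (a ∸ 1) * b) (*-identityʳ k) R-zero)
          (*-identityʳ (k ∸ 1)))

      p≤2k : p ≤ 2 * k
      p≤2k = ≤-trans (∣⇒≤ {{>-nonZero
          (≤-trans (subst (1 ≤_) (sym Q1) 1≤k) (m≤m+n (Q 1) (R 1)))}} p∣Q+R)
        (≤-trans (≤-reflexive (cong₂ _+_ Q1 R1)) (+-monoʳ-≤ k (≤-trans (m∸n≤m k 1) (m≤m+n k 0))))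

theorem1p13 : (k : ℕ) .{{_ : NonZero k}} → 2 ≤ k →
    (α : (p : ℕ) → Fin ((p ∸ 1) / k) → ℤ) →
    (∀ p → Prime p → Odd p → k ∣ p ∸ 1 → RepresentsPowerResidues k p (α p)) →
    (∀ m → Odd m → Finite (E k α m))
    × Empty (E k α 1)
    × (∀ m → 3 ≤ m → Odd m → ∀ p → Prime p → k * m + 1 < p →
    p ∈ E k α m ⇔
    ((+ p ≡ 1ℤ [mod 2 * k ])
    × ((p ∣ (k * m) !⟨ k ⟩ + (k * m ∸ 1) !⟨ k ⟩)
    ⊎ (∃ λ l → 1 ≤ l × l ≤ (m ∸ 1) / 2
    × p ∣ !-quotient k (k * m ∸ k * l) (k * l)
    + !-quotient k (k * m ∸ k * l ∸ 1) (k * l ∸ 1)))))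
theorem1p13 k 2≤k α α-represents =
  (λ m m-odd → E-finite k 2≤k α α-represents m-odd) ,
  E-1-empty k 2≤k α α-represents ,
  λ m _ m-odd p p-prime km+1<p →
    let E⇔ = E⇔∣q+r k 2≤k α α-represents m-odd p-prime km+1<p in
    mk⇔
      (λ p∈E → let 2k∣p-1 , l , l≤h , p∣q+r = to E⇔ p∈E in
        from (≡1⇔∣ p-prime) 2k∣p-1 , split m p l l≤h p∣q+r)
      (λ (p≡1 , p∣) → from E⇔ (to (≡1⇔∣ p-prime) p≡1 , join m p p∣))
  where
  Q+R : ∀ m → q k 2≤k m 0 + r k 2≤k m 0 ≡ Q k 2≤k m + R k 2≤k m
  Q+R m = cong₂ _+_ (q-zero k 2≤k m) (r-zero k 2≤k m)

  split : ∀ m p l → l ≤ (m ∸ 1) / 2 → p ∣ q k 2≤k m l + r k 2≤k m l →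
          p ∣ Q k 2≤k m + R k 2≤k m
          ⊎ ∃ λ l → 1 ≤ l × l ≤ (m ∸ 1) / 2 × p ∣ q k 2≤k m l + r k 2≤k m l
  split m p zero    l≤h p∣q+r = inj₁ (subst (p ∣_) (Q+R m) p∣q+r)
  split m p (suc l) l≤h p∣q+r = inj₂ (suc l , s≤s z≤n , l≤h , p∣q+r)

  join : ∀ m p → p ∣ Q k 2≤k m + R k 2≤k m
         ⊎ (∃ λ l → 1 ≤ l × l ≤ (m ∸ 1) / 2 × p ∣ q k 2≤k m l + r k 2≤k m l) →
         ∃ λ l → l ≤ (m ∸ 1) / 2 × p ∣ q k 2≤k m l + r k 2≤k m l
  join m p (inj₁ p∣Q+R)                = 0 , z≤n , subst (p ∣_) (sym (Q+R m)) p∣Q+R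
  join m p (inj₂ (l , 1≤l , l≤h , p∣)) = l , l≤h , p∣
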